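{- Let $$F(n,t)=\frac{\prod_{j=1}^s\Gamma(a_jn+b_jt+1)}{\prod_{j=1}^u\Gamma(c_jn+d_jt+1)},$$ where $a_j,b_j$ ($1\le j\le s$) and $c_j,d_j$ ($1\le j\le u$) are integers with $\sum_{j=1}^s b_j\ne\sum_{j=1}^u d_j$. For each $n=0,1,2,\ldots$ let $M(n)$ be a non-negative integer, and suppose that all the gamma values occurring in $F(n,t)$ are well defined for $0\le t\le M(n)$. Put $$F_n=\sum_{t=0}^{M(n)}\frac{d}{dt}F(n,t)$$ (the derivative with respect to $t$, evaluated at the integers $t=0,1,\ldots,M(n)$ and summed). Then for each $n=0,1,2,\ldots$ we have $F_n=p_n-\gamma q_n$ with $$q_n=\Bigl(\sum_{j=1}^s b_j-\sum_{j=1}^u d_j\Bigr)\sum_{k=0}^{M(n)}F(n,k)$$ and $$p_n=\sum_{k=0}^{M(n)}F(n,k)\Bigl(\sum_{j=1}^s b_jH_{a_jn+b_jk}-\sum_{j=1}^u d_jH_{c_jn+d_jk}\Bigr).$$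
   Context: $\gamma$ is Euler's constant; $H_m=\sum_{j=1}^m1/j$ is the $m$th harmonic number, $H_0=0$. A gamma value $\Gamma(an+bt+1)$ is called well defined if $an+bt+1$ is not zero or a negative integer. -}

module Defs where

open import Level using (Level; suc; _⊔_)
open import Algebra.Bundles using (CommutativeRing; Semiring)
import Algebra.Definitions.RawSemiring as RawSemiringDefs
open import Data.Fin.Base using (Fin; toℕ)
open import Data.Integer.Base as ℤ using (ℤ; +_; -[1+_])
open import Data.Nat.Base as ℕ using (ℕ; _!)
open import Data.Product.Base using (∃-syntax; _×_)
open import Relation.Binary.Core using (Rel)
open import Relation.Binary.Definitions using (tri<; tri≈; tri>)
open import Relation.Binary.Structures using (IsStrictTotalOrder)

-- The classical notion: `IsStrictTotalOrder` includes trichotomy, and the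
-- inverse is a total operation whose value at 0# is unconstrained.
record OrderedField (a ℓ₁ ℓ₂ : Level) : Set (suc (a ⊔ ℓ₁ ⊔ ℓ₂)) where
  infix  4 _<_
  infix  8 _⁻¹
  field
    commutativeRing : CommutativeRing a ℓ₁

  open CommutativeRing commutativeRing public

  field
    _⁻¹                : Carrier → Carrier
    _<_                : Rel Carrier ℓ₂
    1≉0                : 1# ≉ 0#
    ⁻¹-cong            : ∀ {x y} → x ≈ y → x ⁻¹ ≈ y ⁻¹
    ⁻¹-inverseʳ        : ∀ x → x ≉ 0# → x * x ⁻¹ ≈ 1#
    isStrictTotalOrder : IsStrictTotalOrder _≈_ _<_
    +-monoʳ-<          : ∀ x {y z} → y < z → x + y < x + z
    *-pos              : ∀ {x y} → 0# < x → 0# < y → 0# < x * y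

  open IsStrictTotalOrder isStrictTotalOrder public using (compare)

module OrderedFieldDefs {a ℓ₁ ℓ₂} (K : OrderedField a ℓ₁ ℓ₂) where
  open OrderedField K
  open RawSemiringDefs (Semiring.rawSemiring semiring) public using (sum; product; _^_)
  open RawSemiringDefs (Semiring.rawSemiring semiring) using () renaming (_×_ to _·_)

  infixl 7 _/_
  infix  4 _⟶_

  _/_ : Carrier → Carrier → Carrier
  x / y = x * y ⁻¹

  fromℕ : ℕ → Carrier
  fromℕ n = n · 1#

  fromℤ : ℤ → Carrier
  fromℤ (+ n)    = fromℕ n
  fromℤ -[1+ n ] = - fromℕ (ℕ.suc n)

  ∣_∣ : Carrier → Carrier
  ∣ x ∣ with compare x 0#
  ... | tri< _ _ _ = - x
  ... | tri≈ _ _ _ = x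
  ... | tri> _ _ _ = x

  ∑< : ℕ → (ℕ → Carrier) → Carrier
  ∑< n f = sum {n} (λ i → f (toℕ i))

  ∑≤ : ℕ → (ℕ → Carrier) → Carrier
  ∑≤ n = ∑< (ℕ.suc n)

  ∏≤ : ℕ → (ℕ → Carrier) → Carrier
  ∏≤ n f = product {ℕ.suc n} (λ i → f (toℕ i))

  _⟶_ : (ℕ → Carrier) → Carrier → Set (a ⊔ ℓ₂)
  f ⟶ L = ∀ ε → 0# < ε → ∃[ N ] (∀ n → N ℕ.≤ n → ∣ f n - L ∣ < ε)

  Cauchy : (ℕ → Carrier) → Set (a ⊔ ℓ₂)
  Cauchy f = ∀ ε → 0# < ε →
    ∃[ N ] (∀ m n → N ℕ.≤ m → N ℕ.≤ n → ∣ f m - f n ∣ < ε)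

  HasDerivAt : (Carrier → Carrier) → Carrier → Carrier → Set (a ⊔ ℓ₁ ⊔ ℓ₂)
  HasDerivAt f x L = ∀ ε → 0# < ε → ∃[ δ ] 0# < δ ×
    (∀ h → h ≉ 0# → ∣ h ∣ < δ → ∣ (f (x + h) - f x) / h - L ∣ < ε)

-- The field of real numbers, axiomatised as the complete Archimedean ordered
-- field, which is unique up to isomorphism.
record RealField (a ℓ₁ ℓ₂ : Level) : Set (suc (a ⊔ ℓ₁ ⊔ ℓ₂)) where
  field
    orderedField : OrderedField a ℓ₁ ℓ₂

  open OrderedField orderedField public
  open OrderedFieldDefs orderedField public

  field
    archimedean : ∀ x → ∃[ n ] x < fromℕ n
    complete    : ∀ f → Cauchy f → ∃[ L ] f ⟶ L

module GammaDefs {a ℓ₁ ℓ₂} (ℝ : RealField a ℓ₁ ℓ₂) where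
  open RealField ℝ public

  IsExp : (Carrier → Carrier) → Set (a ⊔ ℓ₂)
  IsExp exp = ∀ x → (λ N → ∑< N (λ k → x ^ k / fromℕ (k !))) ⟶ exp x

  -- Nothing is required of log x for x ≤ 0.
  IsLog : (exp log : Carrier → Carrier) → Set (a ⊔ ℓ₁ ⊔ ℓ₂)
  IsLog exp log = ∀ x → 0# < x → exp (log x) ≈ x

  harmonic : ℕ → Carrier
  harmonic m = ∑< m (λ j → 1# / fromℕ (ℕ.suc j))

  IsEulerConstant : (log : Carrier → Carrier) → Carrier → Set (a ⊔ ℓ₂)
  IsEulerConstant log γ = (λ N → harmonic N - log (fromℕ N)) ⟶ γ

  -- z is not zero or a negative integer, i.e. Γ(z) is well defined.
  NonPole : Carrier → Set ℓ₁
  NonPole z = ∀ m → z ≉ - fromℕ m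

  -- Euler's limit Γ(z) = lim N! N^z / (z (z+1) ⋯ (z+N)), with N^z = exp (z log N).
  -- Nothing is required of Γ at its poles.
  IsGamma : (exp log Γ : Carrier → Carrier) → Set (a ⊔ ℓ₁ ⊔ ℓ₂)
  IsGamma exp log Γ = ∀ z → NonPole z →
    (λ N → (fromℕ (N !) * exp (z * log (fromℕ N))) / ∏≤ N (λ m → z + fromℕ m)) ⟶ Γ z

  -- Only used at non-negative indices: the value at negative ones is arbitrary.
  H : ℤ → Carrier
  H (+ m)    = harmonic m
  H -[1+ _ ] = 0#

  gammaArg : ℤ → ℤ → ℕ → Carrier → Carrier
  gammaArg α β n t = fromℤ α * fromℕ n + fromℤ β * t + 1#

  ∏Γ : (Γ : Carrier → Carrier) {r : ℕ} (α β : Fin r → ℤ) → ℕ → Carrier → Carrier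
  ∏Γ Γ α β n t = product (λ j → Γ (gammaArg (α j) (β j) n t))

  -- Γ has no zeros, so the denominator is nonzero wherever its factors are well defined.
  gammaQuotient : (Γ : Carrier → Carrier) {s u : ℕ} (a b : Fin s → ℤ) (c d : Fin u → ℤ) →
                  ℕ → Carrier → Carrier
  gammaQuotient Γ a b c d n t = ∏Γ Γ a b n t / ∏Γ Γ c d n t

  ∑βH : {r : ℕ} (α β : Fin r → ℤ) → ℕ → ℕ → Carrier
  ∑βH α β n k = sum (λ j → fromℤ (β j) * H (α j ℤ.* + n ℤ.+ β j ℤ.* + k))

∑ℤ : {r : ℕ} → (Fin r → ℤ) → ℤ
∑ℤ = RawSemiringDefs.sum ℤ.+-*-rawSemiring

{-# OPTIONS --safe #-}

-- Euler's limit writes Γ(z + h)/Γ(z), for z = m + 1, as the limit of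
-- exp (h (log N - ∑ 1/(z + j))) · ∏ e^(h/(z + j)) / (1 + h/(z + j)), j = 0, …, N.
-- From 1 + x ≤ eˣ ≤ 1/(1 - x), each factor of the product lies between 1 and
-- 1/(1 - h²/(z + j)²), while log N - ∑ 1/(z + j) → H_m - γ.  Hence
-- Γ(z)(1 + h(H_m - γ)) ≤ Γ(z + h) and Γ(z + h)(1 - Ch²)(1 - h(H_m - γ)) ≤ Γ(z),
-- which gives Γ′(z) = Γ(z)(H_m - γ) without the continuity of exp or Γ.
-- The logarithmic derivative of F(n, ·) is then a sum over the gamma factors,
-- each of whose arguments is a positive integer because it is not a pole.

module Submission where

open import Defs
import Algebra.Properties.AbelianGroup as AbelianGroupProperties
import Algebra.Properties.Monoid.Sum as MonoidSum
import Algebra.Properties.Ring as RingProperties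
import Algebra.Properties.Semiring.Exp as SemiringExp
import Algebra.Properties.Semiring.Mult as SemiringMult
import Algebra.Properties.Semiring.Sum as SemiringSum
import Algebra.Solver.Ring as RingSolver
open import Algebra.Solver.Ring.AlmostCommutativeRing using (_-Raw-AlmostCommutative⟶_; fromCommutativeRing)
open import Data.Fin.Base using (Fin; toℕ)
open import Data.Integer.Base as ℤ using (ℤ; +_; -[1+_])
import Data.Integer.Properties as ℤₚ
open import Data.Maybe.Base using (Maybe; just; nothing)
open import Data.Nat.Base as ℕ using (ℕ; zero; suc; _!)
import Data.Nat.Properties as ℕₚ
open import Data.Product.Base using (Σ-syntax; ∃-syntax; _×_; _,_; proj₁; proj₂)
open import Data.Sum.Base using (_⊎_; inj₁; inj₂)
open import Function.Base using (_∘_)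
open import Level using (_⊔_)
open import Relation.Binary.Bundles using (StrictPartialOrder)
import Relation.Binary.Construct.StrictToNonStrict as StrictToNonStrict
open import Relation.Binary.Definitions using (tri<; tri≈; tri>)
open import Relation.Binary.PropositionalEquality as ≡ using (_≡_; _≢_)
import Relation.Binary.Reasoning.Setoid as SetoidReasoning
import Relation.Binary.Reasoning.StrictPartialOrder as StrictPartialOrderReasoning
open import Relation.Binary.Structures using (IsStrictTotalOrder)
open import Relation.Nullary using (yes; no; contradiction)

-- Every estimate is made for a fixed increment h and at each finite N, with an error Ch² in which C
-- does not depend on N. Weak inequalities survive N → ∞, so the limits in N and in h are never
-- interchanged. The functions exp and Γ are known only through pointwise limits. Even their
-- compatibility with `≈`, and the law exp (x + y) = exp x exp y, must be extracted from these
-- limits; for the latter the Cauchy product is developed. Inverting the denominator of F needs Γ >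
-- 0 at positive integers. Limits of positive terms may vanish, so an induction on Euler's sequence
-- bounds it below by a positive constant; exp (log N) = N is used there. Derivatives are carried
-- through products as expansions with remainder h² r(h), r bounded near 0. Such remainders are
-- closed under products and inverses by plain algebra, whereas difference quotients would call for
-- continuity arguments.

module OrderedFieldProperties {a ℓ₁ ℓ₂} (K : OrderedField a ℓ₁ ℓ₂) where
  open OrderedField K hiding (zero)
  open OrderedFieldDefs K
  open RingProperties ring
  open AbelianGroupProperties +-abelianGroup using (⁻¹-∙-comm)
  open SemiringMult semiring using (×-homo-+; ×1-homo-*)
  private
    module Ord = IsStrictTotalOrder isStrictTotalOrder

  -- Embedding of the natural numbers and the integers.

  fromℕ-+ : ∀ m n → fromℕ (m ℕ.+ n) ≈ fromℕ m + fromℕ n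
  fromℕ-+ = ×-homo-+ 1#

  fromℕ-* : ∀ m n → fromℕ (m ℕ.* n) ≈ fromℕ m * fromℕ n
  fromℕ-* = ×1-homo-*

  fromℕ-1 : fromℕ 1 ≈ 1#
  fromℕ-1 = +-identityʳ 1#

  fromℤ-neg : ∀ i → fromℤ (ℤ.- i) ≈ - fromℤ i
  fromℤ-neg (+ zero)   = sym -0#≈0#
  fromℤ-neg (+ suc n)  = refl
  fromℤ-neg (-[1+ n ]) = sym (-‿involutive _)

  fromℤ-⊖ : ∀ m n → fromℤ (m ℤ.⊖ n) ≈ fromℕ m - fromℕ n
  fromℤ-⊖ m zero = sym (trans (+-congˡ -0#≈0#) (+-identityʳ _))
  fromℤ-⊖ zero (suc n) = sym (+-identityˡ _)
  fromℤ-⊖ (suc m) (suc n) = begin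
    fromℤ (suc m ℤ.⊖ suc n)             ≡⟨ ≡.cong fromℤ (ℤₚ.[1+m]⊖[1+n]≡m⊖n m n) ⟩
    fromℤ (m ℤ.⊖ n)                     ≈⟨ fromℤ-⊖ m n ⟩
    fromℕ m - fromℕ n                   ≈⟨ +-congʳ (+-identityˡ _) ⟨
    0# + fromℕ m - fromℕ n              ≈⟨ +-congʳ (+-congʳ (-‿inverseʳ 1#)) ⟨
    1# - 1# + fromℕ m - fromℕ n         ≈⟨ +-congʳ (+-assoc _ _ _) ⟩
    1# + (- 1# + fromℕ m) - fromℕ n     ≈⟨ +-congʳ (+-congˡ (+-comm _ _)) ⟩
    1# + (fromℕ m - 1#) - fromℕ n       ≈⟨ +-congʳ (+-assoc _ _ _) ⟨
    1# + fromℕ m - 1# - fromℕ n         ≈⟨ +-assoc _ _ _ ⟩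
    1# + fromℕ m + (- 1# - fromℕ n)     ≈⟨ +-congˡ (⁻¹-∙-comm _ _) ⟩
    fromℕ (suc m) - fromℕ (suc n)       ∎
    where open SetoidReasoning setoid

  fromℤ-+ : ∀ i j → fromℤ (i ℤ.+ j) ≈ fromℤ i + fromℤ j
  fromℤ-+ (+ m)      (+ n)      = fromℕ-+ m n
  fromℤ-+ (+ m)      (-[1+ n ]) = fromℤ-⊖ m (suc n)
  fromℤ-+ (-[1+ m ]) (+ n)      = trans (fromℤ-⊖ n (suc m)) (+-comm _ _)
  fromℤ-+ (-[1+ m ]) (-[1+ n ]) = begin
    - fromℕ (suc (suc (m ℕ.+ n)))        ≡⟨ ≡.cong (λ k → - fromℕ (suc k)) (ℕₚ.+-suc m n) ⟨
    - fromℕ (suc m ℕ.+ suc n)            ≈⟨ -‿cong (fromℕ-+ (suc m) (suc n)) ⟩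
    - (fromℕ (suc m) + fromℕ (suc n))    ≈⟨ ⁻¹-∙-comm _ _ ⟨
    - fromℕ (suc m) - fromℕ (suc n)      ∎
    where open SetoidReasoning setoid

  private
    fromℤ-*-+ : ∀ m j → fromℤ (+ m ℤ.* j) ≈ fromℕ m * fromℤ j
    fromℤ-*-+ zero j = trans (reflexive (≡.cong fromℤ (ℤₚ.*-zeroˡ j))) (sym (zeroˡ _))
    fromℤ-*-+ (suc m) j = begin
      fromℤ (+ suc m ℤ.* j)          ≡⟨ ≡.cong fromℤ (ℤₚ.suc-* (+ m) j) ⟩
      fromℤ (j ℤ.+ + m ℤ.* j)        ≈⟨ fromℤ-+ j _ ⟩
      fromℤ j + fromℤ (+ m ℤ.* j)    ≈⟨ +-cong (sym (*-identityˡ _)) (fromℤ-*-+ m j) ⟩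
      1# * fromℤ j + fromℕ m * fromℤ j ≈⟨ distribʳ _ _ _ ⟨
      fromℕ (suc m) * fromℤ j        ∎
      where open SetoidReasoning setoid

  fromℤ-* : ∀ i j → fromℤ (i ℤ.* j) ≈ fromℤ i * fromℤ j
  fromℤ-* (+ m) j = fromℤ-*-+ m j
  fromℤ-* (-[1+ m ]) j = begin
    fromℤ (ℤ.- + suc m ℤ.* j)      ≡⟨ ≡.cong fromℤ (ℤₚ.neg-distribˡ-* (+ suc m) j) ⟨
    fromℤ (ℤ.- (+ suc m ℤ.* j))    ≈⟨ fromℤ-neg (+ suc m ℤ.* j) ⟩
    - fromℤ (+ suc m ℤ.* j)        ≈⟨ -‿cong (fromℤ-*-+ (suc m) j) ⟩
    - (fromℕ (suc m) * fromℤ j)    ≈⟨ -‿distribˡ-* _ _ ⟩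
    - fromℕ (suc m) * fromℤ j      ∎
    where open SetoidReasoning setoid

  private
    -- fromℤ (+ 1) is 1# + 0#; the solver constant 1 should be 1# on the nose.
    coefficient : ℤ → Carrier
    coefficient (+ 1) = 1#
    coefficient i     = fromℤ i

    coefficient≈fromℤ : ∀ i → coefficient i ≈ fromℤ i
    coefficient≈fromℤ (+ 0)           = refl
    coefficient≈fromℤ (+ 1)           = sym fromℕ-1
    coefficient≈fromℤ (+ suc (suc n)) = refl
    coefficient≈fromℤ (-[1+ n ])      = refl

    coefficient-morphism : ℤ.+-*-rawRing -Raw-AlmostCommutative⟶ fromCommutativeRing commutativeRing
    coefficient-morphism = record
      { ⟦_⟧    = coefficient
      ; +-homo = λ i j → via (i ℤ.+ j) (fromℤ-+ i j) (+-cong (≈c i) (≈c j))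
      ; *-homo = λ i j → via (i ℤ.* j) (fromℤ-* i j) (*-cong (≈c i) (≈c j))
      ; -‿homo = λ i → via (ℤ.- i) (fromℤ-neg i) (-‿cong (≈c i))
      ; 0-homo = refl
      ; 1-homo = refl
      }
      where
      ≈c = coefficient≈fromℤ
      via : ∀ i {y z} → fromℤ i ≈ y → z ≈ y → coefficient i ≈ z
      via i p q = trans (≈c i) (trans p (sym q))

    coefficient≟ : ∀ i j → Maybe (coefficient i ≈ coefficient j)
    coefficient≟ i j with i ℤₚ.≟ j
    ... | yes ≡.refl = just refl
    ... | no _       = nothing

  -- Integer coefficients are compared by computation, so numerical terms cancel during
  -- normalisation; equality in the abstract field does not compute.
  module Solver = RingSolver ℤ.+-*-rawRing (fromCommutativeRing commutativeRing)
                    coefficient-morphism coefficient≟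
  open Solver using (solve; _:=_; _:+_; _:*_; _:-_; :-_; con)

  -- Order, multiplication and inverses.

  strictPartialOrder : StrictPartialOrder a ℓ₁ ℓ₂
  strictPartialOrder = record { isStrictPartialOrder = Ord.isStrictPartialOrder }

  module ≤-Reasoning = StrictPartialOrderReasoning strictPartialOrder

  private
    module NonStrict = StrictToNonStrict _≈_ _<_

  open NonStrict public using (_≤_)
  open NonStrict using () renaming (<⇒≤ to weaken)

  <⇒≤ : ∀ {x y} → x < y → x ≤ y
  <⇒≤ = weaken

  ≈⇒≤ : ∀ {x y} → x ≈ y → x ≤ y
  ≈⇒≤ = inj₂

  ≤-trans : ∀ {x y z} → x ≤ y → y ≤ z → x ≤ z
  ≤-trans = NonStrict.trans isEquivalence Ord.<-resp-≈ Ord.trans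

  ≤-refl : ∀ {x} → x ≤ x
  ≤-refl = inj₂ refl

  ≤-antisym : ∀ {x y} → x ≤ y → y ≤ x → x ≈ y
  ≤-antisym = NonStrict.antisym isEquivalence Ord.trans Ord.irrefl

  <-≤-trans : ∀ {x y z} → x < y → y ≤ z → x < z
  <-≤-trans = NonStrict.<-≤-trans Ord.trans Ord.<-respʳ-≈

  ≤-<-trans : ∀ {x y z} → x ≤ y → y < z → x < z
  ≤-<-trans = NonStrict.≤-<-trans sym Ord.trans Ord.<-respˡ-≈

  <-irrefl : ∀ {x y} → x ≈ y → x < y → ∀ {b} {B : Set b} → B
  <-irrefl x≈y x<y = contradiction x<y (Ord.irrefl x≈y)

  ≤⇒≯ : ∀ {x y} → x ≤ y → y < x → ∀ {b} {B : Set b} → B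
  ≤⇒≯ x≤y y<x = <-irrefl refl (≤-<-trans x≤y y<x)

  ≤-cong : ∀ {x x′ y y′} → x ≈ x′ → y ≈ y′ → x ≤ y → x′ ≤ y′
  ≤-cong p q x≤y = ≤-trans (inj₂ (sym p)) (≤-trans x≤y (inj₂ q))

  <-cong : ∀ {x x′ y y′} → x ≈ x′ → y ≈ y′ → x < y → x′ < y′
  <-cong p q x<y = ≤-<-trans (inj₂ (sym p)) (<-≤-trans x<y (inj₂ q))

  ≤-total : ∀ x y → x ≤ y ⊎ y ≤ x
  ≤-total = NonStrict.total compare

  ≤-∨-> : ∀ x y → x ≤ y ⊎ y < x
  ≤-∨-> x y with compare x y
  ... | tri< x<y _ _ = inj₁ (inj₁ x<y)
  ... | tri≈ _ x≈y _ = inj₁ (inj₂ x≈y)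
  ... | tri> _ _ x>y = inj₂ x>y

  pos⇒≉0 : ∀ {x} → 0# < x → x ≉ 0#
  pos⇒≉0 0<x x≈0 = <-irrefl (sym x≈0) 0<x

  +-monoʳ-≤ : ∀ x {y z} → y ≤ z → x + y ≤ x + z
  +-monoʳ-≤ x (inj₁ y<z) = inj₁ (+-monoʳ-< x y<z)
  +-monoʳ-≤ x (inj₂ y≈z) = inj₂ (+-congˡ y≈z)

  +-monoˡ-≤ : ∀ x {y z} → y ≤ z → y + x ≤ z + x
  +-monoˡ-≤ x y≤z = ≤-cong (+-comm _ _) (+-comm _ _) (+-monoʳ-≤ x y≤z)

  +-monoˡ-< : ∀ x {y z} → y < z → y + x < z + x
  +-monoˡ-< x y<z = <-cong (+-comm _ _) (+-comm _ _) (+-monoʳ-< x y<z)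

  +-mono-≤ : ∀ {x x′ y y′} → x ≤ x′ → y ≤ y′ → x + y ≤ x′ + y′
  +-mono-≤ p q = ≤-trans (+-monoˡ-≤ _ p) (+-monoʳ-≤ _ q)

  +-mono-≤-< : ∀ {x x′ y y′} → x ≤ x′ → y < y′ → x + y < x′ + y′
  +-mono-≤-< p q = ≤-<-trans (+-monoˡ-≤ _ p) (+-monoʳ-< _ q)

  +-nonneg : ∀ {x y} → 0# ≤ x → 0# ≤ y → 0# ≤ x + y
  +-nonneg p q = ≤-cong (+-identityˡ 0#) refl (+-mono-≤ p q)

  +-nonneg-pos : ∀ {x y} → 0# ≤ x → 0# < y → 0# < x + y
  +-nonneg-pos p q = <-cong (+-identityˡ 0#) refl (+-mono-≤-< p q)

  +-pos-nonneg : ∀ {x y} → 0# < x → 0# ≤ y → 0# < x + y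
  +-pos-nonneg p q = <-cong refl (+-comm _ _) (+-nonneg-pos q p)

  ≤-from-gap : ∀ {x y e} → 0# ≤ e → x + e ≈ y → x ≤ y
  ≤-from-gap {x} 0≤e p = ≤-cong (+-identityʳ x) p (+-monoʳ-≤ x 0≤e)

  <-from-gap : ∀ {x y e} → 0# < e → x + e ≈ y → x < y
  <-from-gap {x} 0<e p = <-cong (+-identityʳ x) p (+-monoʳ-< x 0<e)

  x≤y⇒0≤y-x : ∀ {x y} → x ≤ y → 0# ≤ y - x
  x≤y⇒0≤y-x {x} p = ≤-cong (-‿inverseʳ x) refl (+-monoˡ-≤ (- x) p)

  x<y⇒0<y-x : ∀ {x y} → x < y → 0# < y - x
  x<y⇒0<y-x {x} p = <-cong (-‿inverseʳ x) refl (+-monoˡ-< (- x) p)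

  neg-mono-≤ : ∀ {x y} → x ≤ y → - y ≤ - x
  neg-mono-≤ {x} {y} p = ≤-from-gap (x≤y⇒0≤y-x p) (solve 2 (λ x y → :- y :+ (y :- x) := :- x) refl x y)

  *-nonneg : ∀ {x y} → 0# ≤ x → 0# ≤ y → 0# ≤ x * y
  *-nonneg (inj₁ p) (inj₁ q) = inj₁ (*-pos p q)
  *-nonneg (inj₂ p) _        = inj₂ (sym (trans (*-congʳ (sym p)) (zeroˡ _)))
  *-nonneg (inj₁ _) (inj₂ q) = inj₂ (sym (trans (*-congˡ (sym q)) (zeroʳ _)))

  *-monoʳ-≤ : ∀ {z x y} → 0# ≤ z → x ≤ y → z * x ≤ z * y
  *-monoʳ-≤ {z} {x} {y} 0≤z p = ≤-from-gap (*-nonneg 0≤z (x≤y⇒0≤y-x p))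
    (solve 3 (λ x y z → z :* x :+ z :* (y :- x) := z :* y) refl x y z)

  *-monoˡ-≤ : ∀ {z x y} → 0# ≤ z → x ≤ y → x * z ≤ y * z
  *-monoˡ-≤ 0≤z p = ≤-cong (*-comm _ _) (*-comm _ _) (*-monoʳ-≤ 0≤z p)

  *-monoʳ-< : ∀ {z x y} → 0# < z → x < y → z * x < z * y
  *-monoʳ-< {z} {x} {y} 0<z p = <-from-gap (*-pos 0<z (x<y⇒0<y-x p))
    (solve 3 (λ x y z → z :* x :+ z :* (y :- x) := z :* y) refl x y z)

  *-mono-≤ : ∀ {x x′ y y′} → 0# ≤ x′ → 0# ≤ y → x ≤ x′ → y ≤ y′ → x * y ≤ x′ * y′
  *-mono-≤ 0≤x′ 0≤y p q = ≤-trans (*-monoˡ-≤ 0≤y p) (*-monoʳ-≤ 0≤x′ q)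

  *-cancelˡ-≤ : ∀ {z x y} → 0# < z → z * x ≤ z * y → x ≤ y
  *-cancelˡ-≤ {z} {x} {y} 0<z p with ≤-∨-> x y
  ... | inj₁ x≤y = x≤y
  ... | inj₂ y<x = ≤⇒≯ p (*-monoʳ-< 0<z y<x)

  square-nonneg : ∀ x → 0# ≤ x * x
  square-nonneg x with ≤-total 0# x
  ... | inj₁ 0≤x = *-nonneg 0≤x 0≤x
  ... | inj₂ x≤0 = ≤-cong refl (solve 1 (λ x → :- x :* :- x := x :* x) refl x) (*-nonneg 0≤-x 0≤-x)
    where 0≤-x = ≤-cong -0#≈0# refl (neg-mono-≤ x≤0)

  0<1 : 0# < 1#
  0<1 with square-nonneg 1#
  ... | inj₁ 0<1*1 = <-cong refl (*-identityˡ 1#) 0<1*1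
  ... | inj₂ 0≈1*1 = contradiction (trans (sym (*-identityˡ 1#)) (sym 0≈1*1)) 1≉0

  0≤1 : 0# ≤ 1#
  0≤1 = inj₁ 0<1

  fromℕ-nonneg : ∀ n → 0# ≤ fromℕ n
  fromℕ-nonneg zero    = ≤-refl
  fromℕ-nonneg (suc n) = +-nonneg 0≤1 (fromℕ-nonneg n)

  fromℕ-pos : ∀ n → 0# < fromℕ (suc n)
  fromℕ-pos n = +-pos-nonneg 0<1 (fromℕ-nonneg n)

  fromℕ-mono-≤ : ∀ {m n} → m ℕ.≤ n → fromℕ m ≤ fromℕ n
  fromℕ-mono-≤ {m} {n} m≤n = ≤-from-gap (fromℕ-nonneg (n ℕ.∸ m))
    (trans (sym (fromℕ-+ m (n ℕ.∸ m))) (reflexive (≡.cong fromℕ (ℕₚ.m+[n∸m]≡n m≤n))))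

  fromℕ-!-pos : ∀ n → 0# < fromℕ (n !)
  fromℕ-!-pos n = <-≤-trans (fromℕ-pos 0) (fromℕ-mono-≤ (ℕₚ.1≤n! n))

  inverseʳ : ∀ {x} → 0# < x → x * x ⁻¹ ≈ 1#
  inverseʳ 0<x = ⁻¹-inverseʳ _ (pos⇒≉0 0<x)

  ⁻¹-pos : ∀ {x} → 0# < x → 0# < x ⁻¹
  ⁻¹-pos {x} 0<x with ≤-∨-> (x ⁻¹) 0#
  ... | inj₂ p = p
  ... | inj₁ p = ≤⇒≯ (≤-cong (inverseʳ 0<x) (zeroʳ x) (*-monoʳ-≤ (<⇒≤ 0<x) p)) 0<1

  /-pos : ∀ {x y} → 0# < x → 0# < y → 0# < x / y
  /-pos 0<x 0<y = *-pos 0<x (⁻¹-pos 0<y)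

  /-nonneg : ∀ {x y} → 0# ≤ x → 0# < y → 0# ≤ x / y
  /-nonneg 0≤x 0<y = *-nonneg 0≤x (<⇒≤ (⁻¹-pos 0<y))

  /-cong : ∀ {x x′ y y′} → x ≈ x′ → y ≈ y′ → x / y ≈ x′ / y′
  /-cong p q = *-cong p (⁻¹-cong q)

  x/y*y≈x : ∀ {x y} → y ≉ 0# → x / y * y ≈ x
  x/y*y≈x {x} {y} y≉0 = trans (solve 3 (λ x y i → x :* i :* y := x :* (y :* i)) refl x y (y ⁻¹))
    (trans (*-congˡ (⁻¹-inverseʳ y y≉0)) (*-identityʳ x))

  /-unique : ∀ {x y z} → y ≉ 0# → z * y ≈ x → x / y ≈ z
  /-unique {x} {y} {z} y≉0 p = trans (*-congʳ (sym p))
    (trans (*-assoc z y _) (trans (*-congˡ (⁻¹-inverseʳ y y≉0)) (*-identityʳ z)))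

  *-cancelˡ-≈ : ∀ {z x y} → z ≉ 0# → z * x ≈ z * y → x ≈ y
  *-cancelˡ-≈ {z} {x} {y} z≉0 p = trans (sym (/-unique z≉0 (*-comm x z)))
    (trans (/-cong p refl) (/-unique z≉0 (*-comm y z)))

  ≤-/ : ∀ {x y z} → 0# < y → x * y ≤ z → x ≤ z / y
  ≤-/ {x} {y} {z} 0<y p = *-cancelˡ-≤ 0<y
    (≤-cong (*-comm x y) (trans (sym (x/y*y≈x (pos⇒≉0 0<y))) (*-comm _ y)) p)

  /-≤ : ∀ {x y z} → 0# < y → z ≤ x * y → z / y ≤ x
  /-≤ {x} {y} {z} 0<y p = *-cancelˡ-≤ 0<y
    (≤-cong (trans (sym (x/y*y≈x (pos⇒≉0 0<y))) (*-comm _ y)) (*-comm x y) p)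

  half : ∀ ε → 0# < ε → ∃[ δ ] 0# < δ × δ + δ ≈ ε
  half ε 0<ε = ε / (1# + 1#) , /-pos 0<ε 0<2 ,
    trans (solve 1 (λ x → x :+ x := x :* (con (+ 1) :+ con (+ 1))) refl _) (x/y*y≈x (pos⇒≉0 0<2))
    where 0<2 = +-pos-nonneg 0<1 0≤1

  min : ∀ δ₁ δ₂ → 0# < δ₁ → 0# < δ₂ → ∃[ δ ] 0# < δ × δ ≤ δ₁ × δ ≤ δ₂
  min δ₁ δ₂ p q with ≤-total δ₁ δ₂
  ... | inj₁ δ₁≤δ₂ = δ₁ , p , ≤-refl , δ₁≤δ₂
  ... | inj₂ δ₂≤δ₁ = δ₂ , q , δ₂≤δ₁ , ≤-refl

  -x≤0 : ∀ {x} → 0# ≤ x → - x ≤ 0#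
  -x≤0 p = ≤-cong refl -0#≈0# (neg-mono-≤ p)

  -- Absolute value.

  x≤∣x∣ : ∀ x → x ≤ ∣ x ∣
  x≤∣x∣ x with compare x 0#
  ... | tri< x<0 _ _ = ≤-trans (<⇒≤ x<0) (≤-cong -0#≈0# refl (neg-mono-≤ (<⇒≤ x<0)))
  ... | tri≈ _ _ _   = ≤-refl
  ... | tri> _ _ _   = ≤-refl

  -x≤∣x∣ : ∀ x → - x ≤ ∣ x ∣
  -x≤∣x∣ x with compare x 0#
  ... | tri< _ _ _   = ≤-refl
  ... | tri≈ _ x≈0 _ = ≤-trans (-x≤0 (≈⇒≤ (sym x≈0))) (≈⇒≤ (sym x≈0))
  ... | tri> _ _ 0<x = ≤-trans (-x≤0 (<⇒≤ 0<x)) (<⇒≤ 0<x)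

  -- With the two bounds above, this is all that is later used of the trichotomy behind `∣_∣`.
  ∣∣-case : ∀ x → ∣ x ∣ ≈ x ⊎ ∣ x ∣ ≈ - x
  ∣∣-case x with compare x 0#
  ... | tri< _ _ _ = inj₂ refl
  ... | tri≈ _ _ _ = inj₁ refl
  ... | tri> _ _ _ = inj₁ refl

  ∣∣-nonneg : ∀ x → 0# ≤ ∣ x ∣
  ∣∣-nonneg x with ≤-total 0# x
  ... | inj₁ 0≤x = ≤-trans 0≤x (x≤∣x∣ x)
  ... | inj₂ x≤0 = ≤-trans (≤-cong -0#≈0# refl (neg-mono-≤ x≤0)) (-x≤∣x∣ x)

  ∣x∣≤ : ∀ {x c} → x ≤ c → - x ≤ c → ∣ x ∣ ≤ c
  ∣x∣≤ {x} p q with ∣∣-case x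
  ... | inj₁ e = ≤-trans (≈⇒≤ e) p
  ... | inj₂ e = ≤-trans (≈⇒≤ e) q

  ∣∣-≤-cong : ∀ {x y} → x ≈ y → ∣ x ∣ ≤ ∣ y ∣
  ∣∣-≤-cong {x} {y} p = ∣x∣≤ (≤-trans (≈⇒≤ p) (x≤∣x∣ y)) (≤-trans (≈⇒≤ (-‿cong p)) (-x≤∣x∣ y))

  ∣∣-cong : ∀ {x y} → x ≈ y → ∣ x ∣ ≈ ∣ y ∣
  ∣∣-cong p = ≤-antisym (∣∣-≤-cong p) (∣∣-≤-cong (sym p))

  0≤x⇒∣x∣≈x : ∀ {x} → 0# ≤ x → ∣ x ∣ ≈ x
  0≤x⇒∣x∣≈x {x} 0≤x = ≤-antisym (∣x∣≤ ≤-refl (≤-trans (-x≤0 0≤x) 0≤x)) (x≤∣x∣ x)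

  ∣-x∣≤∣x∣ : ∀ x → ∣ - x ∣ ≤ ∣ x ∣
  ∣-x∣≤∣x∣ x = ∣x∣≤ (-x≤∣x∣ x) (≤-cong (sym (-‿involutive x)) refl (x≤∣x∣ x))

  ∣x+y∣≤∣x∣+∣y∣ : ∀ x y → ∣ x + y ∣ ≤ ∣ x ∣ + ∣ y ∣
  ∣x+y∣≤∣x∣+∣y∣ x y = ∣x∣≤ (+-mono-≤ (x≤∣x∣ x) (x≤∣x∣ y))
    (≤-cong (⁻¹-∙-comm x y) refl (+-mono-≤ (-x≤∣x∣ x) (-x≤∣x∣ y)))

  private
    x*y≤∣x∣*∣y∣ : ∀ x y → x * y ≤ ∣ x ∣ * ∣ y ∣
    x*y≤∣x∣*∣y∣ x y with ∣∣-case x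
    ... | inj₁ e = ≤-trans (≈⇒≤ (*-congʳ (sym e))) (*-monoʳ-≤ (∣∣-nonneg x) (x≤∣x∣ y))
    ... | inj₂ e = ≤-trans
      (≈⇒≤ (trans (solve 2 (λ x y → x :* y := :- x :* :- y) refl x y) (*-congʳ (sym e))))
      (*-monoʳ-≤ (∣∣-nonneg x) (-x≤∣x∣ y))

  ∣x*y∣≤∣x∣*∣y∣ : ∀ x y → ∣ x * y ∣ ≤ ∣ x ∣ * ∣ y ∣
  ∣x*y∣≤∣x∣*∣y∣ x y = ∣x∣≤ (x*y≤∣x∣*∣y∣ x y)
    (≤-trans (≈⇒≤ (-‿distribʳ-* x y))
      (≤-trans (x*y≤∣x∣*∣y∣ x (- y)) (*-monoʳ-≤ (∣∣-nonneg x) (∣-x∣≤∣x∣ y))))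

-- Finite sums and products.

module BigOperatorProperties {a ℓ₁ ℓ₂} (K : OrderedField a ℓ₁ ℓ₂) where
  open OrderedField K hiding (zero)
  open OrderedFieldDefs K
  open OrderedFieldProperties K
  private
    module S = SemiringSum semiring
    module P = MonoidSum *-monoid

  ∑<-cong : ∀ n {f g} → (∀ i → f i ≈ g i) → ∑< n f ≈ ∑< n g
  ∑<-cong n p = S.sum-cong-≋ {n} (p ∘ toℕ)

  ∑<-+ : ∀ n f g → ∑< n (λ i → f i + g i) ≈ ∑< n f + ∑< n g
  ∑<-+ n f g = S.∑-distrib-+ {n} (f ∘ toℕ) (g ∘ toℕ)

  ∑<-*ˡ : ∀ n c f → ∑< n (λ i → c * f i) ≈ c * ∑< n f
  ∑<-*ˡ n c f = sym (S.*-distribˡ-sum {n} c (f ∘ toℕ))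

  ∑<-split : ∀ m n f → ∑< (m ℕ.+ n) f ≈ ∑< m f + ∑< n (λ j → f (m ℕ.+ j))
  ∑<-split zero    n f = sym (+-identityˡ _)
  ∑<-split (suc m) n f = trans (+-congˡ (∑<-split m n (f ∘ suc))) (sym (+-assoc _ _ _))

  ∑<-nonneg : ∀ n {f} → (∀ i → 0# ≤ f i) → 0# ≤ ∑< n f
  ∑<-nonneg zero    p = ≤-refl
  ∑<-nonneg (suc n) p = +-nonneg (p 0) (∑<-nonneg n (p ∘ suc))

  ∑<-mono-≤ : ∀ n {f g} → (∀ i → f i ≤ g i) → ∑< n f ≤ ∑< n g
  ∑<-mono-≤ zero    p = ≤-refl
  ∑<-mono-≤ (suc n) p = +-mono-≤ (p 0) (∑<-mono-≤ n (p ∘ suc))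

  ∣∑<∣≤∑<∣∣ : ∀ n f → ∣ ∑< n f ∣ ≤ ∑< n (∣_∣ ∘ f)
  ∣∑<∣≤∑<∣∣ zero    f = ≈⇒≤ (0≤x⇒∣x∣≈x ≤-refl)
  ∣∑<∣≤∑<∣∣ (suc n) f =
    ≤-trans (∣x+y∣≤∣x∣+∣y∣ _ _) (+-monoʳ-≤ _ (∣∑<∣≤∑<∣∣ n (f ∘ suc)))

  ∏< : ℕ → (ℕ → Carrier) → Carrier
  ∏< n f = product {n} (λ i → f (toℕ i))

  ∏<-cong : ∀ n {f g} → (∀ i → f i ≈ g i) → ∏< n f ≈ ∏< n g
  ∏<-cong n p = P.sum-cong-≋ {n} (p ∘ toℕ)

  ∏<-suc : ∀ n f → ∏< (suc n) f ≈ ∏< n f * f n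
  ∏<-suc zero    f = *-comm _ _
  ∏<-suc (suc n) f = trans (*-congˡ (∏<-suc n (f ∘ suc))) (sym (*-assoc _ _ _))

  product-pos : ∀ {n} {f : Fin n → Carrier} → (∀ i → 0# < f i) → 0# < product f
  product-pos {zero}  p = 0<1
  product-pos {suc n} p = *-pos (p Fin.zero) (product-pos (p ∘ Fin.suc))

  ∏<-pos : ∀ n {f} → (∀ i → 0# < f i) → 0# < ∏< n f
  ∏<-pos n p = product-pos {n} (p ∘ toℕ)

-- Limits of sequences.

module LimitProperties {a ℓ₁ ℓ₂} (K : OrderedField a ℓ₁ ℓ₂) where
  open OrderedField K hiding (zero)
  open OrderedFieldDefs K
  open OrderedFieldProperties K
  open Solver using (solve; _:=_; _:+_; _:*_; _:-_; :-_; con)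
  open ≤-Reasoning

  ∣x-y∣<ε⇒x<y+ε : ∀ {x y ε} → ∣ x - y ∣ < ε → x < y + ε
  ∣x-y∣<ε⇒x<y+ε {x} {y} p = <-cong (solve 2 (λ x y → y :+ (x :- y) := x) refl x y) refl
    (+-monoʳ-< y (≤-<-trans (x≤∣x∣ (x - y)) p))

  ∣x-y∣<ε⇒y<x+ε : ∀ {x y ε} → ∣ x - y ∣ < ε → y < x + ε
  ∣x-y∣<ε⇒y<x+ε {x} {y} p = <-cong (solve 2 (λ x y → x :+ (:- (x :- y)) := y) refl x y) refl
    (+-monoʳ-< x (≤-<-trans (-x≤∣x∣ (x - y)) p))

  ⟶-const : ∀ c → (λ _ → c) ⟶ c
  ⟶-const c ε 0<ε = 0 , λ _ _ →
    ≤-<-trans (≈⇒≤ (trans (∣∣-cong (-‿inverseʳ c)) (0≤x⇒∣x∣≈x ≤-refl))) 0<ε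

  ⟶-cong : ∀ {f g L M} → (∀ n → f n ≈ g n) → L ≈ M → f ⟶ L → g ⟶ M
  ⟶-cong p q f⟶L ε 0<ε with f⟶L ε 0<ε
  ... | N , h = N , λ n N≤n → ≤-<-trans (∣∣-≤-cong (+-cong (sym (p n)) (-‿cong (sym q)))) (h n N≤n)

  ⟶-reindex : ∀ {f L} (φ : ℕ → ℕ) → (∀ n → n ℕ.≤ φ n) → f ⟶ L → (f ∘ φ) ⟶ L
  ⟶-reindex φ n≤φn f⟶L ε 0<ε with f⟶L ε 0<ε
  ... | N , h = N , λ n N≤n → h (φ n) (ℕₚ.≤-trans N≤n (n≤φn n))

  ⟶-squeeze : ∀ {f g} → (∀ n → ∣ f n ∣ ≤ g n) → g ⟶ 0# → f ⟶ 0#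
  ⟶-squeeze {f} {g} p g⟶0 ε 0<ε with g⟶0 ε 0<ε
  ... | N , h = N , λ n N≤n → begin-strict
    ∣ f n - 0# ∣  ≤⟨ ∣∣-≤-cong (solve 1 (λ x → x :- con (+ 0) := x) refl (f n)) ⟩
    ∣ f n ∣       ≤⟨ p n ⟩
    g n           ≈⟨ solve 1 (λ x → x :- con (+ 0) := x) refl (g n) ⟨
    g n - 0#      ≤⟨ x≤∣x∣ _ ⟩
    ∣ g n - 0# ∣  <⟨ h n N≤n ⟩
    ε             ∎

  ⟶-+ : ∀ {f g L M} → f ⟶ L → g ⟶ M → (λ n → f n + g n) ⟶ (L + M)
  ⟶-+ {f} {g} {L} {M} f⟶L g⟶M ε 0<ε with half ε 0<ε
  ... | δ , 0<δ , δ+δ≈ε with f⟶L δ 0<δ | g⟶M δ 0<δ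
  ... | N₁ , h₁ | N₂ , h₂ = N₁ ℕ.⊔ N₂ , λ n N≤n → begin-strict
    ∣ f n + g n - (L + M) ∣        ≤⟨ ∣∣-≤-cong (solve 4 (λ x y l m → x :+ y :- (l :+ m) := x :- l :+ (y :- m)) refl _ _ _ _) ⟩
    ∣ f n - L + (g n - M) ∣        ≤⟨ ∣x+y∣≤∣x∣+∣y∣ _ _ ⟩
    ∣ f n - L ∣ + ∣ g n - M ∣      <⟨ +-mono-≤-< (<⇒≤ (h₁ n (ℕₚ.m⊔n≤o⇒m≤o N₁ N₂ N≤n))) (h₂ n (ℕₚ.m⊔n≤o⇒n≤o N₁ N₂ N≤n)) ⟩
    δ + δ                          ≈⟨ δ+δ≈ε ⟩
    ε                              ∎

  ⟶-* : ∀ {f g L M} → f ⟶ L → g ⟶ M → (λ n → f n * g n) ⟶ (L * M)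
  ⟶-* {f} {g} {L} {M} f⟶L g⟶M ε 0<ε
    -- With η ≤ 1 the quadratic term ∣x∣∣y∣ is at most η, so the whole error is at most Kη for K = 1
    -- + ∣L∣ + ∣M∣. Dividing ε by K + 1 instead of K leaves a spare η that makes the final
    -- inequality strict.
    with min 1# (ε / (1# + ∣ L ∣ + ∣ M ∣ + 1#)) 0<1 (/-pos 0<ε 0<K+1)
    where 0<K+1 = +-nonneg-pos (+-nonneg (+-nonneg 0≤1 (∣∣-nonneg L)) (∣∣-nonneg M)) 0<1
  ... | η , 0<η , η≤1 , η≤ε/K with f⟶L η 0<η | g⟶M η 0<η
  ... | N₁ , h₁ | N₂ , h₂ = N₁ ℕ.⊔ N₂ , λ n N≤n →
    let p = h₁ n (ℕₚ.m⊔n≤o⇒m≤o N₁ N₂ N≤n)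
        q = h₂ n (ℕₚ.m⊔n≤o⇒n≤o N₁ N₂ N≤n)
        K = 1# + ∣ L ∣ + ∣ M ∣
        0≤K = +-nonneg (+-nonneg 0≤1 (∣∣-nonneg L)) (∣∣-nonneg M)
        x = f n - L
        y = g n - M
    in begin-strict
    ∣ f n * g n - L * M ∣                  ≤⟨ ∣∣-≤-cong (solve 4 (λ f g l m →
                                                f :* g :- l :* m := (f :- l) :* (g :- m) :+ l :* (g :- m) :+ m :* (f :- l))
                                                refl (f n) (g n) L M) ⟩
    ∣ x * y + L * y + M * x ∣              ≤⟨ ∣x+y∣≤∣x∣+∣y∣ _ _ ⟩
    ∣ x * y + L * y ∣ + ∣ M * x ∣          ≤⟨ +-monoˡ-≤ _ (∣x+y∣≤∣x∣+∣y∣ _ _) ⟩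
    ∣ x * y ∣ + ∣ L * y ∣ + ∣ M * x ∣      ≤⟨ +-mono-≤ (+-mono-≤ (∣x*y∣≤∣x∣*∣y∣ x y) (∣x*y∣≤∣x∣*∣y∣ L y)) (∣x*y∣≤∣x∣*∣y∣ M x) ⟩
    ∣ x ∣ * ∣ y ∣ + ∣ L ∣ * ∣ y ∣ + ∣ M ∣ * ∣ x ∣
      ≤⟨ +-mono-≤ (+-mono-≤ (*-mono-≤ 0≤1 (∣∣-nonneg y) (≤-trans (<⇒≤ p) η≤1) (<⇒≤ q)) (*-monoʳ-≤ (∣∣-nonneg L) (<⇒≤ q)))
                  (*-monoʳ-≤ (∣∣-nonneg M) (<⇒≤ p)) ⟩
    1# * η + ∣ L ∣ * η + ∣ M ∣ * η         ≈⟨ solve 3 (λ l m η → con (+ 1) :* η :+ l :* η :+ m :* η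
                                                := (con (+ 1) :+ l :+ m) :* η :+ con (+ 0)) refl ∣ L ∣ ∣ M ∣ η ⟩
    K * η + 0#                             <⟨ +-monoʳ-< _ 0<η ⟩
    K * η + η                              ≈⟨ solve 2 (λ k η → k :* η :+ η := (k :+ con (+ 1)) :* η) refl K η ⟩
    (K + 1#) * η                           ≤⟨ *-monoʳ-≤ (+-nonneg 0≤K 0≤1) η≤ε/K ⟩
    (K + 1#) * (ε / (K + 1#))              ≈⟨ *-comm _ _ ⟩
    ε / (K + 1#) * (K + 1#)                ≈⟨ x/y*y≈x (pos⇒≉0 (+-nonneg-pos 0≤K 0<1)) ⟩
    ε                                      ∎

  ⟶-*ˡ : ∀ {f L} c → f ⟶ L → (λ n → c * f n) ⟶ (c * L)
  ⟶-*ˡ c = ⟶-* (⟶-const c)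

  ⟶-sub : ∀ {f g L M} → f ⟶ L → g ⟶ M → (λ n → f n - g n) ⟶ (L - M)
  ⟶-sub f⟶L g⟶M = ⟶-cong (λ _ → -1*x≈) -1*x≈ (⟶-+ f⟶L (⟶-*ˡ (- 1#) g⟶M))
    where -1*x≈ : ∀ {x y} → x + - 1# * y ≈ x - y
          -1*x≈ = solve 2 (λ x y → x :+ (:- con (+ 1)) :* y := x :- y) refl _ _

  -- Were M < L, then half of the gap as tolerance in both limits would give L < L. The threshold N
  -- serves bounds that fail for the first terms, such as 1 + x against the partial sums of the
  -- exponential series.
  ⟶-mono-≤ : ∀ {f g L M} → f ⟶ L → g ⟶ M → ∀ N → (∀ n → N ℕ.≤ n → f n ≤ g n) → L ≤ M
  ⟶-mono-≤ {f} {g} {L} {M} f⟶L g⟶M N₀ f≤g with ≤-∨-> L M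
  ... | inj₁ L≤M = L≤M
  ... | inj₂ M<L with half (L - M) (x<y⇒0<y-x M<L)
  ... | δ , 0<δ , δ+δ≈L-M with f⟶L δ 0<δ | g⟶M δ 0<δ
  ... | N₁ , h₁ | N₂ , h₂ = <-irrefl refl (begin-strict
    L              <⟨ ∣x-y∣<ε⇒y<x+ε (h₁ n (ℕₚ.≤-trans (ℕₚ.m≤n⊔m N₀ N₁) (ℕₚ.m≤m⊔n _ N₂))) ⟩
    f n + δ        ≤⟨ +-monoˡ-≤ δ (f≤g n (ℕₚ.≤-trans (ℕₚ.m≤m⊔n N₀ N₁) (ℕₚ.m≤m⊔n _ N₂))) ⟩
    g n + δ        <⟨ +-monoˡ-< δ (∣x-y∣<ε⇒x<y+ε (h₂ n (ℕₚ.m≤n⊔m _ N₂))) ⟩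
    M + δ + δ      ≈⟨ +-assoc _ _ _ ⟩
    M + (δ + δ)    ≈⟨ +-congˡ δ+δ≈L-M ⟩
    M + (L - M)    ≈⟨ solve 2 (λ l m → m :+ (l :- m) := l) refl L M ⟩
    L              ∎)
    where n = N₀ ℕ.⊔ N₁ ℕ.⊔ N₂

  ⟶-unique : ∀ {f L M} → f ⟶ L → f ⟶ M → L ≈ M
  ⟶-unique f⟶L f⟶M = ≤-antisym (⟶-mono-≤ f⟶L f⟶M 0 λ _ _ → ≤-refl)
                               (⟶-mono-≤ f⟶M f⟶L 0 λ _ _ → ≤-refl)

-- Cauchy products of series.

module CauchyProduct {a ℓ₁ ℓ₂} (K : OrderedField a ℓ₁ ℓ₂) where
  open OrderedField K hiding (zero)
  open OrderedFieldDefs K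
  open OrderedFieldProperties K
  open BigOperatorProperties K
  open Solver using (solve; _:=_; _:+_; _:*_; _:-_; :-_; con)
  open ≤-Reasoning

  -- conv p q n = ∑ p i * q j over i + j = n; the recursion shifts p.
  conv : (p q : ℕ → Carrier) → ℕ → Carrier
  conv p q zero    = p 0 * q 0
  conv p q (suc n) = p 0 * q (suc n) + conv (p ∘ suc) q n

  conv-cong : ∀ n {p p′ q q′} → (∀ i → p i ≈ p′ i) → (∀ i → q i ≈ q′ i) → conv p q n ≈ conv p′ q′ n
  conv-cong zero    f g = *-cong (f 0) (g 0)
  conv-cong (suc n) f g = +-cong (*-cong (f 0) (g (suc n))) (conv-cong n (f ∘ suc) g)

  conv-nonneg : ∀ n {p q} → (∀ i → 0# ≤ p i) → (∀ i → 0# ≤ q i) → 0# ≤ conv p q n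
  conv-nonneg zero    f g = *-nonneg (f 0) (g 0)
  conv-nonneg (suc n) f g = +-nonneg (*-nonneg (f 0) (g (suc n))) (conv-nonneg n (f ∘ suc) g)

  conv-*ˡ : ∀ n c p q → conv (λ i → c * p i) q n ≈ c * conv p q n
  conv-*ˡ zero    c p q = *-assoc _ _ _
  conv-*ˡ (suc n) c p q = trans (+-cong (*-assoc _ _ _) (conv-*ˡ n c (p ∘ suc) q)) (sym (distribˡ _ _ _))

  conv-*ʳ : ∀ n c p q → conv p (λ i → c * q i) n ≈ c * conv p q n
  conv-*ʳ zero    c p q = solve 3 (λ c p q → p :* (c :* q) := c :* (p :* q)) refl c (p 0) (q 0)
  conv-*ʳ (suc n) c p q = trans (+-congˡ (conv-*ʳ n c (p ∘ suc) q))
    (solve 4 (λ c p q r → p :* (c :* q) :+ c :* r := c :* (p :* q :+ r)) refl c (p 0) (q (suc n)) _)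

  conv-suc : ∀ n p q → conv p q (suc n) ≈ conv p (q ∘ suc) n + p (suc n) * q 0
  conv-suc zero    p q = refl
  conv-suc (suc n) p q = trans (+-congˡ (conv-suc n (p ∘ suc) q)) (sym (+-assoc _ _ _))

  -- On the antidiagonal i + j = n the weight c + n splits as (c + i) + j: the Leibniz rule for x
  -- d/dx on coefficients. The constant c makes the induction go through, since shifting p by one
  -- turns c into c + 1.
  conv-weighted : ∀ n c p q →
    conv (λ i → (c + fromℕ i) * p i) q n + conv p (λ i → fromℕ i * q i) n ≈ (c + fromℕ n) * conv p q n
  conv-weighted zero c p q =
    solve 3 (λ c p q → (c :+ con (+ 0)) :* p :* q :+ p :* (con (+ 0) :* q) := (c :+ con (+ 0)) :* (p :* q))
      refl c (p 0) (q 0)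
  conv-weighted (suc n) c p q = begin-equality
    (c + 0#) * p 0 * q (suc n) + conv (λ i → (c + fromℕ (suc i)) * p (suc i)) q n
      + (p 0 * (fromℕ (suc n) * q (suc n)) + V)
      ≈⟨ +-congʳ (+-congˡ (conv-cong n (λ i → *-congʳ (sym (+-assoc c 1# (fromℕ i)))) (λ _ → refl))) ⟩
    (c + 0#) * p 0 * q (suc n) + U + (p 0 * (fromℕ (suc n) * q (suc n)) + V)
      ≈⟨ solve 6 (λ c p q n u v → (c :+ con (+ 0)) :* p :* q :+ u :+ (p :* (n :* q) :+ v)
                                 := (c :+ n) :* (p :* q) :+ (u :+ v))
           refl c (p 0) (q (suc n)) (fromℕ (suc n)) U V ⟩
    (c + fromℕ (suc n)) * (p 0 * q (suc n)) + (U + V)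
      ≈⟨ +-congˡ (conv-weighted n (c + 1#) (p ∘ suc) q) ⟩
    (c + fromℕ (suc n)) * (p 0 * q (suc n)) + (c + 1# + fromℕ n) * conv (p ∘ suc) q n
      ≈⟨ +-congˡ (*-congʳ (+-assoc c 1# (fromℕ n))) ⟩
    (c + fromℕ (suc n)) * (p 0 * q (suc n)) + (c + fromℕ (suc n)) * conv (p ∘ suc) q n
      ≈⟨ distribˡ _ _ _ ⟨
    (c + fromℕ (suc n)) * conv p q (suc n) ∎
    where
    U = conv (λ i → (c + 1# + fromℕ i) * p (suc i)) q n
    V = conv (p ∘ suc) (λ i → fromℕ i * q i) n

  -- Splits the triangle i + j ≤ N into its row i = 0 and the smaller triangle left after shifting
  -- p.
  ∑<-conv-suc : ∀ N p q →
    ∑< (suc N) (conv p q) ≈ p 0 * ∑< (suc N) q + ∑< N (conv (p ∘ suc) q)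
  ∑<-conv-suc N p q = begin-equality
    p 0 * q 0 + ∑< N (λ n → p 0 * q (suc n) + conv (p ∘ suc) q n)  ≈⟨ +-congˡ (∑<-+ N (λ n → p 0 * q (suc n)) (conv (p ∘ suc) q)) ⟩
    p 0 * q 0 + (∑< N (λ n → p 0 * q (suc n)) + T)                 ≈⟨ +-congˡ (+-congʳ (∑<-*ˡ N (p 0) (q ∘ suc))) ⟩
    p 0 * q 0 + (p 0 * ∑< N (q ∘ suc) + T)                         ≈⟨ +-assoc _ _ _ ⟨
    p 0 * q 0 + p 0 * ∑< N (q ∘ suc) + T                           ≈⟨ +-congʳ (distribˡ _ _ _) ⟨
    p 0 * ∑< (suc N) q + T                                         ∎
    where T = ∑< N (conv (p ∘ suc) q)

  ∑<-tail-bound : ∀ {N M q Q} → N ℕ.≤ M → (∀ i → ∣ q i ∣ ≤ Q i) →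
    ∣ ∑< M q - ∑< N q ∣ ≤ ∑< M Q - ∑< N Q
  ∑<-tail-bound {N} {M} {q} {Q} N≤M q≤Q = begin
    ∣ ∑< M q - ∑< N q ∣            ≤⟨ ∣∣-≤-cong (tail q) ⟩
    ∣ ∑< k (λ j → q (N ℕ.+ j)) ∣   ≤⟨ ∣∑<∣≤∑<∣∣ k (λ j → q (N ℕ.+ j)) ⟩
    ∑< k (λ j → ∣ q (N ℕ.+ j) ∣)   ≤⟨ ∑<-mono-≤ k (λ j → q≤Q (N ℕ.+ j)) ⟩
    ∑< k (λ j → Q (N ℕ.+ j))       ≈⟨ tail Q ⟨
    ∑< M Q - ∑< N Q                ∎
    where
    k = M ℕ.∸ N
    tail : ∀ f → ∑< M f - ∑< N f ≈ ∑< k (λ j → f (N ℕ.+ j))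
    tail f = begin-equality
      ∑< M f - ∑< N f                                   ≡⟨ ≡.cong (λ m → ∑< m f - ∑< N f) (ℕₚ.m+[n∸m]≡n N≤M) ⟨
      ∑< (N ℕ.+ k) f - ∑< N f                           ≈⟨ +-congʳ (∑<-split N k f) ⟩
      ∑< N f + ∑< k (λ j → f (N ℕ.+ j)) - ∑< N f        ≈⟨ solve 2 (λ x y → x :+ y :- x := y) refl _ _ ⟩
      ∑< k (λ j → f (N ℕ.+ j))                          ∎

  -- The left side is a sum of p i * q j over the square [0,N) × [0,M) minus the triangle i + j < N.
  square-triangle-bound : ∀ N M {p q P Q} → N ℕ.≤ M → (∀ i → ∣ p i ∣ ≤ P i) → (∀ i → ∣ q i ∣ ≤ Q i) →
    ∣ ∑< N p * ∑< M q - ∑< N (conv p q) ∣ ≤ ∑< N P * ∑< M Q - ∑< N (conv P Q)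
  square-triangle-bound zero M {q = q} {Q = Q} N≤M p≤P q≤Q = begin
    ∣ 0# * ∑< M q - 0# ∣   ≈⟨ ∣∣-cong (solve 1 (λ x → con (+ 0) :* x :- con (+ 0) := con (+ 0)) refl _) ⟩
    ∣ 0# ∣                 ≈⟨ 0≤x⇒∣x∣≈x ≤-refl ⟩
    0#                     ≈⟨ solve 1 (λ x → con (+ 0) :* x :- con (+ 0) := con (+ 0)) refl _ ⟨
    0# * ∑< M Q - 0#       ∎
  square-triangle-bound (suc N) M {p} {q} {P} {Q} N<M p≤P q≤Q = begin
    ∣ ∑< (suc N) p * ∑< M q - ∑< (suc N) (conv p q) ∣   ≤⟨ ∣∣-≤-cong (peel p q) ⟩
    ∣ p 0 * x + y ∣            ≤⟨ ∣x+y∣≤∣x∣+∣y∣ _ _ ⟩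
    ∣ p 0 * x ∣ + ∣ y ∣        ≤⟨ +-mono-≤ (∣x*y∣≤∣x∣*∣y∣ _ _)
                                    (square-triangle-bound N M (ℕₚ.<⇒≤ N<M) (p≤P ∘ suc) q≤Q) ⟩
    ∣ p 0 ∣ * ∣ x ∣ + Y        ≤⟨ +-monoˡ-≤ Y (*-mono-≤ (≤-trans (∣∣-nonneg _) (p≤P 0)) (∣∣-nonneg x)
                                    (p≤P 0) (∑<-tail-bound N<M q≤Q)) ⟩
    P 0 * X + Y                ≈⟨ peel P Q ⟨
    ∑< (suc N) P * ∑< M Q - ∑< (suc N) (conv P Q) ∎
    where
    x = ∑< M q - ∑< (suc N) q
    y = ∑< N (p ∘ suc) * ∑< M q - ∑< N (conv (p ∘ suc) q)
    X = ∑< M Q - ∑< (suc N) Q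
    Y = ∑< N (P ∘ suc) * ∑< M Q - ∑< N (conv (P ∘ suc) Q)
    peel : ∀ f g → ∑< (suc N) f * ∑< M g - ∑< (suc N) (conv f g) ≈
      f 0 * (∑< M g - ∑< (suc N) g) + (∑< N (f ∘ suc) * ∑< M g - ∑< N (conv (f ∘ suc) g))
    peel f g = trans (+-congˡ (-‿cong (∑<-conv-suc N f g)))
      (solve 5 (λ f F m s t → (f :+ F) :* m :- (f :* s :+ t) := f :* (m :- s) :+ (F :* m :- t)) refl _ _ _ _ _)

  -- Indices i < N and j < M satisfy i + j < N + M, and the further terms of the triangle are
  -- nonnegative.
  square≤triangle : ∀ N M {P Q} → (∀ i → 0# ≤ P i) → (∀ i → 0# ≤ Q i) →
    ∑< N P * ∑< M Q ≤ ∑< (N ℕ.+ M) (conv P Q)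
  square≤triangle zero M {P} {Q} 0≤P 0≤Q =
    ≤-trans (≈⇒≤ (zeroˡ _)) (∑<-nonneg M (λ i → conv-nonneg i 0≤P 0≤Q))
  square≤triangle (suc N) M {P} {Q} 0≤P 0≤Q = begin
    (P 0 + ∑< N (P ∘ suc)) * ∑< M Q           ≈⟨ distribʳ _ _ _ ⟩
    P 0 * ∑< M Q + ∑< N (P ∘ suc) * ∑< M Q    ≤⟨ +-mono-≤ (*-monoʳ-≤ (0≤P 0) M≤) (square≤triangle N M (0≤P ∘ suc) 0≤Q) ⟩
    P 0 * ∑< (suc N ℕ.+ M) Q + ∑< (N ℕ.+ M) (conv (P ∘ suc) Q) ≈⟨ ∑<-conv-suc (N ℕ.+ M) P Q ⟨
    ∑< (suc N ℕ.+ M) (conv P Q)               ∎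
    where
    M≤ : ∑< M Q ≤ ∑< (suc N ℕ.+ M) Q
    M≤ = begin
      ∑< M Q                                            ≈⟨ +-identityʳ _ ⟨
      ∑< M Q + 0#                                       ≤⟨ +-monoʳ-≤ _ (∑<-nonneg (suc N) (λ j → 0≤Q (M ℕ.+ j))) ⟩
      ∑< M Q + ∑< (suc N) (λ j → Q (M ℕ.+ j))           ≈⟨ ∑<-split M (suc N) Q ⟨
      ∑< (M ℕ.+ suc N) Q                                ≡⟨ ≡.cong (λ m → ∑< m Q) (ℕₚ.+-comm M (suc N)) ⟩
      ∑< (suc N ℕ.+ M) Q                                ∎

-- The exponential function from its power series.

module ExponentialProperties {a ℓ₁ ℓ₂} (ℝ : RealField a ℓ₁ ℓ₂)
  (exp : RealField.Carrier ℝ → RealField.Carrier ℝ) (isExp : GammaDefs.IsExp ℝ exp) where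
  open GammaDefs ℝ
  open OrderedFieldProperties orderedField
  open BigOperatorProperties orderedField
  open LimitProperties orderedField
  open CauchyProduct orderedField
  open SemiringExp semiring using (^-congˡ)
  open Solver using (solve; _:=_; _:+_; _:*_; _:-_; :-_; con)
  open ≤-Reasoning

  expTerm : Carrier → ℕ → Carrier
  expTerm x k = x ^ k / fromℕ (k !)

  expTerm-0 : ∀ x → expTerm x 0 ≈ 1#
  expTerm-0 x = /-unique (pos⇒≉0 (fromℕ-!-pos 0)) (trans (*-congˡ fromℕ-1) (*-identityʳ 1#))

  -- Together with the value 1 at k = 0 this recurrence determines the terms, and it stands in for
  -- factorials and binomial coefficients below.
  expTerm-suc : ∀ x k → fromℕ (suc k) * expTerm x (suc k) ≈ x * expTerm x k
  expTerm-suc x k = *-cancelˡ-≈ (pos⇒≉0 (fromℕ-!-pos k)) (begin-equality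
    fromℕ (k !) * (fromℕ (suc k) * expTerm x (suc k))   ≈⟨ solve 3 (λ k s e → k :* (s :* e) := e :* (s :* k)) refl _ _ _ ⟩
    expTerm x (suc k) * (fromℕ (suc k) * fromℕ (k !))   ≈⟨ *-congˡ (fromℕ-* (suc k) (k !)) ⟨
    expTerm x (suc k) * fromℕ (suc k !)                 ≈⟨ x/y*y≈x (pos⇒≉0 (fromℕ-!-pos (suc k))) ⟩
    x * x ^ k                                           ≈⟨ *-congˡ (x/y*y≈x (pos⇒≉0 (fromℕ-!-pos k))) ⟨
    x * (expTerm x k * fromℕ (k !))                     ≈⟨ solve 3 (λ x e k → x :* (e :* k) := k :* (x :* e)) refl _ _ _ ⟩
    fromℕ (k !) * (x * expTerm x k)                     ∎)

  ^-nonneg : ∀ {x} k → 0# ≤ x → 0# ≤ x ^ k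
  ^-nonneg zero    0≤x = 0≤1
  ^-nonneg (suc k) 0≤x = *-nonneg 0≤x (^-nonneg k 0≤x)

  expTerm-nonneg : ∀ {x} k → 0# ≤ x → 0# ≤ expTerm x k
  expTerm-nonneg k 0≤x = /-nonneg (^-nonneg k 0≤x) (fromℕ-!-pos k)

  ∣^∣≤ : ∀ x k → ∣ x ^ k ∣ ≤ ∣ x ∣ ^ k
  ∣^∣≤ x zero    = ≈⇒≤ (0≤x⇒∣x∣≈x 0≤1)
  ∣^∣≤ x (suc k) = ≤-trans (∣x*y∣≤∣x∣*∣y∣ _ _) (*-monoʳ-≤ (∣∣-nonneg x) (∣^∣≤ x k))

  ∣expTerm∣≤ : ∀ x k → ∣ expTerm x k ∣ ≤ expTerm ∣ x ∣ k
  ∣expTerm∣≤ x k = ≤-trans (∣x*y∣≤∣x∣*∣y∣ _ _)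
    (*-mono-≤ (^-nonneg k (∣∣-nonneg x)) (∣∣-nonneg _) (∣^∣≤ x k)
      (≈⇒≤ (0≤x⇒∣x∣≈x (<⇒≤ (⁻¹-pos (fromℕ-!-pos k))))))

  -- Both sides satisfy the recurrence (n + 1) t(n + 1) = (x + y) t(n). For the convolution, n + 1
  -- is distributed over the two factors by `conv-weighted` and absorbed by `expTerm-suc`, in place
  -- of the binomial theorem.
  conv-expTerm : ∀ n x y → conv (expTerm x) (expTerm y) n ≈ expTerm (x + y) n
  conv-expTerm zero x y = trans (*-cong (expTerm-0 x) (expTerm-0 y))
    (trans (*-identityʳ 1#) (sym (expTerm-0 (x + y))))
  conv-expTerm (suc n) x y = *-cancelˡ-≈ (pos⇒≉0 (fromℕ-pos n)) (begin-equality
    fromℕ (suc n) * conv p q (suc n)        ≈⟨ *-congʳ (+-identityˡ _) ⟨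
    (0# + fromℕ (suc n)) * conv p q (suc n) ≈⟨ conv-weighted (suc n) 0# p q ⟨
    (0# + 0#) * p 0 * q (suc n) + conv (λ i → (0# + fromℕ (suc i)) * p (suc i)) q n
      + conv p (λ i → fromℕ i * q i) (suc n)
      -- The terms of weight 0 drop out. In the p-weighted convolution this is the first term,
      -- already exposed by the recursion; in the q-weighted one it is the last, which `conv-suc`
      -- exposes.
      ≈⟨ +-cong (+-congˡ (trans (conv-cong n (λ i → trans (*-congʳ (+-identityˡ _)) (expTerm-suc x i)) (λ _ → refl))
                                (conv-*ˡ n x p q)))
                (trans (conv-suc n p _)
                       (+-congʳ (trans (conv-cong n (λ _ → refl) (expTerm-suc y)) (conv-*ʳ n y p q)))) ⟩
    (0# + 0#) * p 0 * q (suc n) + x * conv p q n + (y * conv p q n + p (suc n) * (0# * q 0))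
      ≈⟨ solve 7 (λ x y c p q p′ q′ → (con (+ 0) :+ con (+ 0)) :* p :* q :+ x :* c :+ (y :* c :+ p′ :* (con (+ 0) :* q′))
                    := (x :+ y) :* c) refl x y (conv p q n) (p 0) (q (suc n)) (p (suc n)) (q 0) ⟩
    (x + y) * conv p q n                    ≈⟨ *-congˡ (conv-expTerm n x y) ⟩
    (x + y) * expTerm (x + y) n             ≈⟨ expTerm-suc (x + y) n ⟨
    fromℕ (suc n) * expTerm (x + y) (suc n) ∎)
    where
    p = expTerm x
    q = expTerm y

  -- Nothing makes the given function respect `≈` a priori; uniqueness of limits does.
  exp-cong : ∀ {x y} → x ≈ y → exp x ≈ exp y
  exp-cong {x} {y} x≈y = ⟶-unique (isExp x)
    (⟶-cong (λ N → ∑<-cong N {expTerm y} {expTerm x} λ k → *-congʳ (^-congˡ k (sym x≈y))) refl (isExp y))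

  -- Replacing x and y by ∣ x ∣ and ∣ y ∣ bounds the square-minus-triangle defect by a
  -- difference of partial sums of exp (∣ x ∣ + ∣ y ∣).
  exp-+ : ∀ x y → exp (x + y) ≈ exp x * exp y
  exp-+ x y = begin-equality
    exp (x + y)                                 ≈⟨ solve 2 (λ a b → a := b :- (b :- a)) refl _ (exp x * exp y) ⟩
    exp x * exp y - (exp x * exp y - exp (x + y)) ≈⟨ +-congˡ (-‿cong (⟶-unique
        (⟶-sub (⟶-* (isExp x) (isExp y)) (isExp (x + y))) (⟶-squeeze bound gap⟶0))) ⟩
    exp x * exp y - 0#                          ≈⟨ solve 1 (λ a → a :- con (+ 0) := a) refl _ ⟩
    exp x * exp y                               ∎
    where
    X = ∣ x ∣
    Y = ∣ y ∣
    z = X + Y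
    S : Carrier → ℕ → Carrier
    S w N = ∑< N (expTerm w)
    conv-S : ∀ N u v → ∑< N (conv (expTerm u) (expTerm v)) ≈ S (u + v) N
    conv-S N u v = ∑<-cong N λ n → conv-expTerm n u v
    gap⟶0 : (λ N → S z (N ℕ.+ N) - S z N) ⟶ 0#
    gap⟶0 = ⟶-cong (λ _ → refl) (-‿inverseʳ (exp z))
      (⟶-sub (⟶-reindex (λ N → N ℕ.+ N) (λ N → ℕₚ.m≤m+n N N) (isExp z)) (isExp z))
    bound : ∀ N → ∣ S x N * S y N - S (x + y) N ∣ ≤ S z (N ℕ.+ N) - S z N
    bound N = begin
      ∣ S x N * S y N - S (x + y) N ∣
        ≈⟨ ∣∣-cong (+-congˡ (-‿cong (conv-S N x y))) ⟨
      ∣ S x N * S y N - ∑< N (conv (expTerm x) (expTerm y)) ∣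
        ≤⟨ square-triangle-bound N N ℕₚ.≤-refl (∣expTerm∣≤ x) (∣expTerm∣≤ y) ⟩
      S X N * S Y N - ∑< N (conv (expTerm X) (expTerm Y))
        ≤⟨ +-monoˡ-≤ _ (square≤triangle N N (λ k → expTerm-nonneg k (∣∣-nonneg x)) (λ k → expTerm-nonneg k (∣∣-nonneg y))) ⟩
      ∑< (N ℕ.+ N) (conv (expTerm X) (expTerm Y)) - ∑< N (conv (expTerm X) (expTerm Y))
        ≈⟨ +-cong (conv-S (N ℕ.+ N) X Y) (-‿cong (conv-S N X Y)) ⟩
      S z (N ℕ.+ N) - S z N ∎

  private
    1+x≤exp-nonneg : ∀ {x} → 0# ≤ x → 1# + x ≤ exp x
    1+x≤exp-nonneg {x} 0≤x = ⟶-mono-≤ (⟶-const _) (isExp x) 2 partial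
      where
      expTerm-1 : expTerm x 1 ≈ x
      expTerm-1 = /-unique (pos⇒≉0 (fromℕ-!-pos 1)) (*-congˡ fromℕ-1)
      partial : ∀ n → 2 ℕ.≤ n → 1# + x ≤ ∑< n (expTerm x)
      partial (suc (suc n)) (ℕ.s≤s (ℕ.s≤s _)) = begin
        1# + x                                    ≈⟨ +-cong (sym (expTerm-0 x)) (sym (expTerm-1)) ⟩
        expTerm x 0 + expTerm x 1                 ≈⟨ +-congˡ (+-identityʳ _) ⟨
        expTerm x 0 + (expTerm x 1 + 0#)          ≤⟨ +-monoʳ-≤ _ (+-monoʳ-≤ _ (∑<-nonneg n λ k → expTerm-nonneg (suc (suc k)) 0≤x)) ⟩
        ∑< (suc (suc n)) (expTerm x)              ∎

    geometric : ∀ x N → (1# - x) * ∑< N (x ^_) + x ^ N ≈ 1#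
    geometric x zero = solve 1 (λ x → (con (+ 1) :- x) :* con (+ 0) :+ con (+ 1) := con (+ 1)) refl x
    geometric x (suc N) = begin-equality
      (1# - x) * (1# + ∑< N (λ k → x * x ^ k)) + x * x ^ N   ≈⟨ +-congʳ (*-congˡ (+-congˡ (∑<-*ˡ N x (x ^_)))) ⟩
      (1# - x) * (1# + x * ∑< N (x ^_)) + x * x ^ N          ≈⟨ solve 3 (λ x g p →
          (con (+ 1) :- x) :* (con (+ 1) :+ x :* g) :+ x :* p := con (+ 1) :- x :+ x :* ((con (+ 1) :- x) :* g :+ p)) refl x _ _ ⟩
      1# - x + x * ((1# - x) * ∑< N (x ^_) + x ^ N)          ≈⟨ +-congˡ (*-congˡ (geometric x N)) ⟩
      1# - x + x * 1#                                        ≈⟨ solve 1 (λ x → con (+ 1) :- x :+ x :* con (+ 1) := con (+ 1)) refl x ⟩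
      1#                                                     ∎

    -- For x ≤ 1 the terms are at most xᵏ, and (1 - x) times a finite geometric sum is 1 - xᴺ ≤ 1;
    -- stopping at finite N covers x = 1 as well. For x ≥ 1 the left side is not positive.
    [1-x]*exp≤1-nonneg : ∀ {x} → 0# ≤ x → (1# - x) * exp x ≤ 1#
    [1-x]*exp≤1-nonneg {x} 0≤x with ≤-total x 1#
    ... | inj₁ x≤1 = ⟶-mono-≤ (⟶-*ˡ (1# - x) (isExp x)) (⟶-const 1#) 0 λ N _ → begin
      (1# - x) * ∑< N (expTerm x)           ≤⟨ *-monoʳ-≤ (x≤y⇒0≤y-x x≤1) (∑<-mono-≤ N expTerm≤^) ⟩
      (1# - x) * ∑< N (x ^_)                ≤⟨ ≤-from-gap (^-nonneg N 0≤x) refl ⟩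
      (1# - x) * ∑< N (x ^_) + x ^ N        ≈⟨ geometric x N ⟩
      1#                                    ∎
      where
      expTerm≤^ : ∀ k → expTerm x k ≤ x ^ k
      expTerm≤^ k = /-≤ (fromℕ-!-pos k) (≤-cong (*-identityʳ _) refl
        (*-monoʳ-≤ (^-nonneg k 0≤x) (≤-cong fromℕ-1 refl (fromℕ-mono-≤ (ℕₚ.1≤n! k)))))
    ... | inj₂ 1≤x = begin
      (1# - x) * exp x        ≈⟨ solve 2 (λ x e → (con (+ 1) :- x) :* e := :- ((x :- con (+ 1)) :* e)) refl x _ ⟩
      - ((x - 1#) * exp x)    ≤⟨ -x≤0 (*-nonneg (x≤y⇒0≤y-x 1≤x) (≤-trans (+-nonneg 0≤1 0≤x) (1+x≤exp-nonneg 0≤x))) ⟩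
      0#                      ≤⟨ 0≤1 ⟩
      1#                      ∎

  exp-0 : exp 0# ≈ 1#
  exp-0 = ≤-antisym
    (≤-cong (solve 1 (λ e → (con (+ 1) :- con (+ 0)) :* e := e) refl _) refl ([1-x]*exp≤1-nonneg ≤-refl))
    (≤-cong (+-identityʳ 1#) refl (1+x≤exp-nonneg ≤-refl))

  exp-inverse : ∀ x → exp x * exp (- x) ≈ 1#
  exp-inverse x = trans (sym (exp-+ x (- x))) (trans (exp-cong (-‿inverseʳ x)) exp-0)

  -- For x ≤ 0, multiplying by exp (- x) > 0 turns the claim into the bound `[1-x]*exp≤1-nonneg` at
  -- - x, which is why that bound comes first.
  1+x≤exp : ∀ x → 1# + x ≤ exp x
  1+x≤exp x with ≤-total 0# x
  ... | inj₁ 0≤x = 1+x≤exp-nonneg 0≤x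
  ... | inj₂ x≤0 = *-cancelˡ-≤ 0<exp-x (begin
    exp (- x) * (1# + x)       ≈⟨ solve 2 (λ e x → e :* (con (+ 1) :+ x) := (con (+ 1) :- (:- x)) :* e) refl _ x ⟩
    (1# - - x) * exp (- x)     ≤⟨ [1-x]*exp≤1-nonneg 0≤-x ⟩
    1#                         ≈⟨ exp-inverse x ⟨
    exp x * exp (- x)          ≈⟨ *-comm _ _ ⟩
    exp (- x) * exp x          ∎)
    where
    0≤-x : 0# ≤ - x
    0≤-x = ≤-from-gap (x≤y⇒0≤y-x x≤0) (solve 1 (λ x → con (+ 0) :+ (con (+ 0) :- x) := :- x) refl x)
    0<exp-x : 0# < exp (- x)
    0<exp-x = <-≤-trans (+-pos-nonneg 0<1 0≤-x) (1+x≤exp-nonneg 0≤-x)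

  exp-pos : ∀ x → 0# < exp x
  exp-pos x with ≤-total 0# x
  ... | inj₁ 0≤x = <-≤-trans (+-pos-nonneg 0<1 0≤x) (1+x≤exp x)
  ... | inj₂ x≤0 with ≤-∨-> (exp x) 0#
  ... | inj₂ 0<e = 0<e
  ... | inj₁ e≤0 = ≤⇒≯ (begin
    1#                    ≈⟨ exp-inverse x ⟨
    exp x * exp (- x)     ≤⟨ *-monoˡ-≤ (≤-trans 0≤1+-x (1+x≤exp (- x))) e≤0 ⟩
    0# * exp (- x)        ≈⟨ zeroˡ _ ⟩
    0#                    ∎) 0<1
    where
    0≤1+-x : 0# ≤ 1# - x
    0≤1+-x = ≤-trans 0≤1 (≤-from-gap (x≤y⇒0≤y-x x≤0) (solve 1 (λ x → con (+ 1) :+ (con (+ 0) :- x) := con (+ 1) :- x) refl x))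

  [1-x]*exp≤1 : ∀ x → (1# - x) * exp x ≤ 1#
  [1-x]*exp≤1 x = begin
    (1# - x) * exp x       ≤⟨ *-monoˡ-≤ (<⇒≤ (exp-pos x)) (1+x≤exp (- x)) ⟩
    exp (- x) * exp x      ≈⟨ *-comm _ _ ⟩
    exp x * exp (- x)      ≈⟨ exp-inverse x ⟩
    1#                     ∎

-- Comparing the products of k and of k + h.

module ShiftedProductBounds {a ℓ₁ ℓ₂} (ℝ : RealField a ℓ₁ ℓ₂)
  (exp : RealField.Carrier ℝ → RealField.Carrier ℝ) (isExp : GammaDefs.IsExp ℝ exp) where
  open GammaDefs ℝ
  open OrderedFieldProperties orderedField
  open BigOperatorProperties orderedField
  open ExponentialProperties ℝ exp isExp
  open Solver using (solve; _:=_; _:+_; _:*_; _:-_; :-_; con)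
  open ≤-Reasoning

  private
    k[1+hk⁻¹]≈k+h : ∀ {k} h → 0# < k → k * (1# + h * k ⁻¹) ≈ k + h
    k[1+hk⁻¹]≈k+h {k} h 0<k = begin-equality
      k * (1# + h * k ⁻¹)     ≈⟨ solve 3 (λ k h i → k :* (con (+ 1) :+ h :* i) := k :+ h :* (k :* i)) refl k h _ ⟩
      k + h * (k * k ⁻¹)      ≈⟨ +-congˡ (trans (*-congˡ (inverseʳ 0<k)) (*-identityʳ h)) ⟩
      k + h                   ∎

    exp-h*-+ : ∀ h x y → exp (h * (x + y)) ≈ exp (h * x) * exp (h * y)
    exp-h*-+ h x y = trans (exp-cong (distribˡ h x y)) (exp-+ _ _)

  -- Multiply k + h = k (1 + h/k) ≤ k exp (h/k) over all factors. The shifted product is the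
  -- denominator of Euler's sequence at z + h, so this bounds that sequence from below.
  shifted-product-≤ : ∀ n {k h} → (∀ j → 0# < k j) → (∀ j → 0# < k j + h) →
    ∏< n (λ j → k j + h) ≤ ∏< n k * exp (h * ∑< n (λ j → k j ⁻¹))
  shifted-product-≤ zero {k} {h} 0<k 0<k+h = ≈⇒≤ (sym (trans (*-congˡ (trans (exp-cong (zeroʳ h)) exp-0)) (*-identityʳ 1#)))
  shifted-product-≤ (suc n) {k} {h} 0<k 0<k+h = begin
    (k 0 + h) * ∏< n (λ j → k (suc j) + h)
      ≤⟨ *-mono-≤ (<⇒≤ (*-pos (0<k 0) (exp-pos _))) (<⇒≤ (∏<-pos n (0<k+h ∘ suc))) first
           (shifted-product-≤ n (0<k ∘ suc) (0<k+h ∘ suc)) ⟩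
    k 0 * exp (h * k 0 ⁻¹) * (∏< n (k ∘ suc) * exp (h * ∑< n (λ j → k (suc j) ⁻¹)))
      ≈⟨ solve 4 (λ k e P E → k :* e :* (P :* E) := k :* P :* (e :* E)) refl _ _ _ _ ⟩
    k 0 * ∏< n (k ∘ suc) * (exp (h * k 0 ⁻¹) * exp (h * ∑< n (λ j → k (suc j) ⁻¹)))
      ≈⟨ *-congˡ (exp-h*-+ h _ _) ⟨
    ∏< (suc n) k * exp (h * ∑< (suc n) (λ j → k j ⁻¹)) ∎
    where
    first : k 0 + h ≤ k 0 * exp (h * k 0 ⁻¹)
    first = ≤-trans (≈⇒≤ (sym (k[1+hk⁻¹]≈k+h h (0<k 0)))) (*-monoʳ-≤ (<⇒≤ (0<k 0)) (1+x≤exp _))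

  -- With x = h/k, multiplying (1 - x) exp x ≤ 1 by k (1 + x) gives (1 - x²) k exp x ≤ k + h; here k
  -- - h > 0 keeps 1 - x nonnegative. The factors 1 - x² are collected by the Weierstrass
  -- inequality: their product is at least 1 minus the sum of the x².
  shifted-product-≥ : ∀ n {k h} → (∀ j → 0# < k j) → (∀ j → 0# < k j + h) → (∀ j → 0# < k j - h) →
    (1# - h * h * ∑< n (λ j → k j ⁻¹ * k j ⁻¹)) * (∏< n k * exp (h * ∑< n (λ j → k j ⁻¹)))
      ≤ ∏< n (λ j → k j + h)
  shifted-product-≥ zero {k} {h} 0<k 0<k+h 0<k-h = ≈⇒≤ (trans (*-congˡ (*-congˡ (trans (exp-cong (zeroʳ h)) exp-0)))
    (solve 1 (λ h → (con (+ 1) :- h :* h :* con (+ 0)) :* (con (+ 1) :* con (+ 1)) := con (+ 1)) refl h))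
  shifted-product-≥ (suc n) {k} {h} 0<k 0<k+h 0<k-h = begin
    (1# - h * h * (i * i + s)) * (k 0 * p * exp (h * (i + σ)))
      ≈⟨ *-congˡ (*-congˡ (exp-h*-+ h i σ)) ⟩
    (1# - h * h * (i * i + s)) * (k 0 * p * (e * E))
      -- The gap is the cross term of (1 - h²i²)(1 - h²s), times the positive products.
      ≤⟨ ≤-from-gap (*-nonneg (*-nonneg (square-nonneg (h * i)) (*-nonneg (square-nonneg h) 0≤s))
                              (<⇒≤ (*-pos (*-pos (0<k 0) (exp-pos _)) (*-pos (∏<-pos n (0<k ∘ suc)) (exp-pos _)))))
           (solve 7 (λ h i s k p e E →
              (con (+ 1) :- h :* h :* (i :* i :+ s)) :* (k :* p :* (e :* E))
                :+ ((h :* i) :* (h :* i)) :* ((h :* h) :* s) :* (k :* e :* (p :* E))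
              := (con (+ 1) :- h :* i) :* e :* (k :* (con (+ 1) :+ h :* i)) :* ((con (+ 1) :- h :* h :* s) :* (p :* E)))
              refl h i s (k 0) p e E) ⟩
    (1# - h * i) * e * (k 0 * (1# + h * i)) * ((1# - h * h * s) * (p * E))
      ≤⟨ *-monoʳ-≤ 0≤first (shifted-product-≥ n (0<k ∘ suc) (0<k+h ∘ suc) (0<k-h ∘ suc)) ⟩
    (1# - h * i) * e * (k 0 * (1# + h * i)) * ∏< n (λ j → k (suc j) + h)
      ≤⟨ *-monoˡ-≤ (<⇒≤ (∏<-pos n (0<k+h ∘ suc))) first ⟩
    (k 0 + h) * ∏< n (λ j → k (suc j) + h) ∎
    where
    i = k 0 ⁻¹
    e = exp (h * i)
    s = ∑< n (λ j → k (suc j) ⁻¹ * k (suc j) ⁻¹)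
    σ = ∑< n (λ j → k (suc j) ⁻¹)
    E = exp (h * σ)
    p = ∏< n (k ∘ suc)
    0≤s : 0# ≤ s
    0≤s = ∑<-nonneg n (λ j → square-nonneg (k (suc j) ⁻¹))
    1-hi-nonneg : 0# ≤ 1# - h * i
    1-hi-nonneg = *-cancelˡ-≤ (0<k 0) (≤-cong (sym (zeroʳ _))
      (trans (sym (k[1+hk⁻¹]≈k+h (- h) (0<k 0))) (*-congˡ (solve 2 (λ h i → con (+ 1) :+ (:- h) :* i := con (+ 1) :- h :* i) refl h i)))
      (<⇒≤ (0<k-h 0)))
    0≤k[1+hi] : 0# ≤ k 0 * (1# + h * i)
    0≤k[1+hi] = ≤-cong refl (sym (k[1+hk⁻¹]≈k+h h (0<k 0))) (<⇒≤ (0<k+h 0))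
    0≤first : 0# ≤ (1# - h * i) * e * (k 0 * (1# + h * i))
    0≤first = *-nonneg (*-nonneg 1-hi-nonneg (<⇒≤ (exp-pos _))) 0≤k[1+hi]
    first : (1# - h * i) * e * (k 0 * (1# + h * i)) ≤ k 0 + h
    first = ≤-trans (*-monoˡ-≤ 0≤k[1+hi] ([1-x]*exp≤1 (h * i)))
      (≈⇒≤ (trans (*-identityˡ _) (k[1+hk⁻¹]≈k+h h (0<k 0))))

  -- Beyond the first term, 1/(z + j + 1)² ≤ 1/(z + j) - 1/(z + j + 1) telescopes to at most 1/z.
  -- The bound is independent of n, as the limit N → ∞ requires.
  ∑1/[z+j]²-bound : ∀ n z → 0# < z →
    ∑< n (λ j → (z + fromℕ j) ⁻¹ * (z + fromℕ j) ⁻¹) ≤ z ⁻¹ * z ⁻¹ + z ⁻¹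
  ∑1/[z+j]²-bound zero z 0<z = +-nonneg (square-nonneg _) (<⇒≤ (⁻¹-pos 0<z))
  ∑1/[z+j]²-bound (suc n) z 0<z = begin
    (z + 0#) ⁻¹ * (z + 0#) ⁻¹ + ∑< n (λ j → (z + (1# + fromℕ j)) ⁻¹ * (z + (1# + fromℕ j)) ⁻¹)
      ≈⟨ +-cong (*-cong (⁻¹-cong (+-identityʳ z)) (⁻¹-cong (+-identityʳ z)))
                (∑<-cong n {λ j → (z + (1# + fromℕ j)) ⁻¹ * (z + (1# + fromℕ j)) ⁻¹}
                  λ j → *-cong (⁻¹-cong (sym (+-assoc _ _ _))) (⁻¹-cong (sym (+-assoc _ _ _)))) ⟩
    i * i + ∑< n (λ j → (z + 1# + fromℕ j) ⁻¹ * (z + 1# + fromℕ j) ⁻¹)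
      ≤⟨ +-monoʳ-≤ _ (∑1/[z+j]²-bound n (z + 1#) 0<z+1) ⟩
    i * i + (w * w + w)
      -- Using i = w + iw twice gives i = w + w² + iw², so w² + w falls short of i by iw².
      ≤⟨ ≤-from-gap (*-nonneg (<⇒≤ (⁻¹-pos 0<z)) (square-nonneg w))
           (solve 2 (λ i w → i :* i :+ (w :* w :+ w) :+ i :* (w :* w) := i :* i :+ (w :+ w :* (w :+ i :* w))) refl i w) ⟩
    i * i + (w + w * (w + i * w))
      ≈⟨ +-congˡ (trans (+-congˡ (trans (*-congˡ (sym i≈w+iw)) (*-comm w i))) (sym i≈w+iw)) ⟩
    i * i + i ∎
    where
    0<z+1 = +-pos-nonneg 0<z 0≤1
    i = z ⁻¹
    w = (z + 1#) ⁻¹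
    i≈w+iw : i ≈ w + i * w
    i≈w+iw = begin-equality
      i                       ≈⟨ *-identityʳ i ⟨
      i * 1#                  ≈⟨ *-congˡ (inverseʳ 0<z+1) ⟨
      i * ((z + 1#) * w)      ≈⟨ solve 3 (λ z i w → i :* ((z :+ con (+ 1)) :* w) := z :* i :* w :+ i :* w) refl z i w ⟩
      z * i * w + i * w       ≈⟨ +-congʳ (trans (*-congʳ (inverseʳ 0<z)) (*-identityˡ w)) ⟩
      w + i * w               ∎

-- The gamma function through Euler's limit.

module GammaProperties {a ℓ₁ ℓ₂} (ℝ : RealField a ℓ₁ ℓ₂)
  (exp log : RealField.Carrier ℝ → RealField.Carrier ℝ) (isExp : GammaDefs.IsExp ℝ exp) (isLog : GammaDefs.IsLog ℝ exp log)
  (γ : RealField.Carrier ℝ) (isEulerConstant : GammaDefs.IsEulerConstant ℝ log γ)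
  (Γ : RealField.Carrier ℝ → RealField.Carrier ℝ) (isGamma : GammaDefs.IsGamma ℝ exp log Γ) where
  open GammaDefs ℝ
  open OrderedFieldProperties orderedField
  open BigOperatorProperties orderedField
  open LimitProperties orderedField
  open ExponentialProperties ℝ exp isExp
  open ShiftedProductBounds ℝ exp isExp
  open Solver using (solve; _:=_; _:+_; _:*_; _:-_; :-_; con)
  open ≤-Reasoning

  gammaSequence : Carrier → ℕ → Carrier
  gammaSequence z N = (fromℕ (N !) * exp (z * log (fromℕ N))) / ∏≤ N (λ m → z + fromℕ m)

  pos⇒NonPole : ∀ {z} → 0# < z → NonPole z
  pos⇒NonPole 0<z m z≈-m = <-irrefl (trans (sym (-‿inverseˡ (fromℕ m))) (+-congʳ (sym z≈-m)))
    (+-pos-nonneg 0<z (fromℕ-nonneg m))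

  Γ-cong : ∀ {z z′} → z ≈ z′ → NonPole z → Γ z ≈ Γ z′
  Γ-cong {z} {z′} z≈z′ z-nonPole = ⟶-unique (isGamma z z-nonPole)
    (⟶-cong (λ N → sym (/-cong (*-congˡ (exp-cong (*-congʳ z≈z′)))
                              (∏<-cong (suc N) {λ m → z + fromℕ m} λ m → +-congʳ z≈z′)))
      refl (isGamma z′ λ m p → z-nonPole m (trans z≈z′ p)))

  1/suc⟶0 : (λ N → 1# / fromℕ (suc N)) ⟶ 0#
  1/suc⟶0 ε 0<ε with archimedean (1# / ε)
  ... | n , 1/ε<n = n , λ N n≤N → begin-strict
    ∣ 1# / fromℕ (suc N) - 0# ∣   ≈⟨ ∣∣-cong (solve 1 (λ x → x :- con (+ 0) := x) refl _) ⟩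
    ∣ 1# / fromℕ (suc N) ∣        ≈⟨ 0≤x⇒∣x∣≈x (<⇒≤ (/-pos 0<1 (fromℕ-pos N))) ⟩
    1# / fromℕ (suc N)            <⟨ bound N n≤N ⟩
    ε                             ∎
    where
    bound : ∀ N → n ℕ.≤ N → 1# / fromℕ (suc N) < ε
    bound N n≤N with ≤-∨-> ε (1# / fromℕ (suc N))
    ... | inj₂ p = p
    ... | inj₁ p = ≤⇒≯ (begin
      fromℕ n                          ≤⟨ fromℕ-mono-≤ (ℕₚ.m≤n⇒m≤1+n n≤N) ⟩
      fromℕ (suc N)                    ≤⟨ ≤-/ 0<ε (≤-trans (*-monoʳ-≤ (fromℕ-nonneg (suc N)) p)
                                            (≈⇒≤ (trans (*-comm _ _) (x/y*y≈x (pos⇒≉0 (fromℕ-pos N)))))) ⟩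
      1# / ε                           ∎) 1/ε<n

  ∑<⟶0 : ∀ k {g : ℕ → ℕ → Carrier} → (∀ j → (λ N → g N j) ⟶ 0#) → (λ N → ∑< k (g N)) ⟶ 0#
  ∑<⟶0 zero    p = ⟶-const 0#
  ∑<⟶0 (suc k) p = ⟶-cong (λ _ → refl) (+-identityʳ 0#) (⟶-+ (p 0) (∑<⟶0 k (p ∘ suc)))

  -- Γ near the positive integer z = m + 1.

  module AtSuc (m : ℕ) where
    z : Carrier
    z = fromℕ (suc m)

    k : ℕ → Carrier
    k j = z + fromℕ j

    0<k : ∀ j → 0# < k j
    0<k j = +-pos-nonneg (fromℕ-pos m) (fromℕ-nonneg j)

    1≤k : ∀ j → 1# ≤ k j
    1≤k j = ≤-from-gap (+-nonneg (fromℕ-nonneg m) (fromℕ-nonneg j)) (sym (+-assoc _ _ _))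

    -- The logarithmic derivative ψ(m + 1).
    ψ : Carrier
    ψ = harmonic m - γ

    σ : ℕ → Carrier
    σ N = ∑< (suc N) (λ j → k j ⁻¹)

    -- Here σ N = H(m + N + 1) - H(m), and H(m + N + 1) differs from H(N) by m + 1 terms, each of
    -- which tends to 0.
    log-σ⟶ψ : (λ N → log (fromℕ N) - σ N) ⟶ ψ
    log-σ⟶ψ = ⟶-cong rearrange (solve 2 (λ x y → x :- y :- con (+ 0) := x :- y) refl _ _)
      (⟶-sub (⟶-sub (⟶-const (harmonic m)) isEulerConstant)
           (∑<⟶0 (suc m) λ j → ⟶-reindex (ℕ._+ j) (λ N → ℕₚ.m≤m+n N j) 1/suc⟶0))
      where
      f : ℕ → Carrier
      f j = 1# / fromℕ (suc j)
      σ≈ : ∀ N → σ N ≈ ∑< (suc N) (λ j → f (m ℕ.+ j))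
      σ≈ N = ∑<-cong (suc N) {λ j → k j ⁻¹} λ j →
        trans (⁻¹-cong (sym (fromℕ-+ (suc m) j))) (sym (*-identityˡ _))
      rearrange : ∀ N → harmonic m - (harmonic N - log (fromℕ N)) - ∑< (suc m) (λ j → f (N ℕ.+ j))
                        ≈ log (fromℕ N) - σ N
      rearrange N = begin-equality
        harmonic m - (harmonic N - L) - t       ≈⟨ solve 4 (λ m n l t → m :- (n :- l) :- t := l :- ((n :+ t) :- m)) refl _ _ _ _ ⟩
        L - (harmonic N + t - harmonic m)       ≈⟨ +-congˡ (-‿cong (+-congʳ (∑<-split N (suc m) f))) ⟨
        L - (harmonic (N ℕ.+ suc m) - harmonic m) ≡⟨ ≡.cong (λ n → L - (harmonic n - harmonic m))
                                                     (≡.trans (ℕₚ.+-suc N m) (≡.trans (≡.cong suc (ℕₚ.+-comm N m)) (≡.sym (ℕₚ.+-suc m N)))) ⟩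
        L - (harmonic (m ℕ.+ suc N) - harmonic m) ≈⟨ +-congˡ (-‿cong (+-congʳ (∑<-split m (suc N) f))) ⟩
        L - (harmonic m + ∑< (suc N) (λ j → f (m ℕ.+ j)) - harmonic m)
          ≈⟨ solve 3 (λ l m s → l :- (m :+ s :- m) := l :- s) refl _ _ _ ⟩
        L - ∑< (suc N) (λ j → f (m ℕ.+ j))      ≈⟨ +-congˡ (-‿cong (σ≈ N)) ⟨
        L - σ N                                 ∎
        where
        L = log (fromℕ N)
        t = ∑< (suc m) (λ j → f (N ℕ.+ j))

    -- The value of `∑1/[z+j]²-bound` at z; it makes the quadratic error uniform in N.
    C : Carrier
    C = z ⁻¹ * z ⁻¹ + z ⁻¹

    C-nonneg : 0# ≤ C
    C-nonneg = +-nonneg (square-nonneg _) (<⇒≤ (⁻¹-pos (fromℕ-pos m)))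

    -- The point w is kept apart from z + h because Γ is later taken at a gamma argument that agrees
    -- with such a sum only up to `≈`. Since every k j is at least 1, ∣h∣ < 1 keeps both k j + h and
    -- k j - h positive.
    module _ {h w} (∣h∣<1 : ∣ h ∣ < 1#) (w≈z+h : w ≈ z + h) where
      0<k+h : ∀ j → 0# < k j + h
      0<k+h j = <-cong refl (solve 2 (λ k h → k :- (:- h) := k :+ h) refl (k j) h)
        (x<y⇒0<y-x (<-≤-trans (≤-<-trans (-x≤∣x∣ h) ∣h∣<1) (1≤k j)))

      0<k-h : ∀ j → 0# < k j - h
      0<k-h j = x<y⇒0<y-x (<-≤-trans (≤-<-trans (x≤∣x∣ h) ∣h∣<1) (1≤k j))

      k+h≈w+j : ∀ j → k j + h ≈ w + fromℕ j
      k+h≈w+j j = trans (solve 3 (λ z j h → z :+ j :+ h := z :+ h :+ j) refl z (fromℕ j) h) (+-congʳ (sym w≈z+h))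

      0<w : 0# < w
      0<w = <-cong refl (trans (k+h≈w+j 0) (+-identityʳ w)) (0<k+h 0)

      private
        module Step (N : ℕ) where
          L f P R E e₁ x : Carrier
          L  = log (fromℕ N)
          f  = fromℕ (N !)
          P  = ∏< (suc N) k
          R  = ∏< (suc N) (λ j → w + fromℕ j)
          E  = exp (h * σ N)
          e₁ = exp (z * L)
          x  = h * (L - σ N)

          R≈ : ∏< (suc N) (λ j → k j + h) ≈ R
          R≈ = ∏<-cong (suc N) {λ j → k j + h} k+h≈w+j

          0<P : 0# < P
          0<P = ∏<-pos (suc N) 0<k

          0<R : 0# < R
          0<R = <-cong refl R≈ (∏<-pos (suc N) 0<k+h)

          -- The exponent hL is split as x + hσ: the part hσ matches the factor E of the product
          -- bounds, and x is the part that converges, to hψ.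
          exp-wL : exp (w * L) ≈ e₁ * (exp x * E)
          exp-wL = begin-equality
            exp (w * L)                         ≈⟨ exp-cong (*-congʳ w≈z+h) ⟩
            exp ((z + h) * L)                   ≈⟨ exp-cong (solve 4 (λ z h l s →
                                                     (z :+ h) :* l := z :* l :+ (h :* (l :- s) :+ h :* s)) refl z h L (σ N)) ⟩
            exp (z * L + (x + h * σ N))         ≈⟨ trans (exp-+ _ _) (*-congˡ (exp-+ _ _)) ⟩
            e₁ * (exp x * E)                    ∎

          0≤Gz : 0# ≤ gammaSequence z N
          0≤Gz = <⇒≤ (/-pos (*-pos (fromℕ-!-pos N) (exp-pos _)) 0<P)

          0≤Gw : 0# ≤ gammaSequence w N
          0≤Gw = <⇒≤ (/-pos (*-pos (fromℕ-!-pos N) (exp-pos _)) 0<R)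

          Gz*P : gammaSequence z N * P ≈ f * e₁
          Gz*P = x/y*y≈x (pos⇒≉0 0<P)

          Gw*R : gammaSequence w N * R ≈ f * exp (w * L)
          Gw*R = x/y*y≈x (pos⇒≉0 0<R)

          -- The exponential of x is traded for 1 + x while N is still finite, so the limit only
          -- passes through an expression linear in x.
          lower : (1# + x) * gammaSequence z N ≤ gammaSequence w N
          lower = ≤-trans (*-monoˡ-≤ 0≤Gz (1+x≤exp x)) (≤-/ 0<R (begin
            exp x * G * R            ≤⟨ *-monoʳ-≤ (*-nonneg (<⇒≤ (exp-pos x)) 0≤Gz)
                                          (≤-trans (≈⇒≤ (sym R≈)) (shifted-product-≤ (suc N) 0<k 0<k+h)) ⟩
            exp x * G * (P * E)      ≈⟨ solve 4 (λ e g p E → e :* g :* (p :* E) := g :* p :* (e :* E)) refl _ _ _ _ ⟩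
            G * P * (exp x * E)      ≈⟨ *-congʳ Gz*P ⟩
            f * e₁ * (exp x * E)     ≈⟨ trans (*-assoc _ _ _) (*-congˡ (sym exp-wL)) ⟩
            f * exp (w * L)          ∎))
            where G = gammaSequence z N

          upper : 0# ≤ 1# - C * (h * h) → (1# - C * (h * h)) * (1# - x) * gammaSequence w N ≤ gammaSequence z N
          upper 0≤κ = ≤-trans (*-monoˡ-≤ 0≤Gw (*-monoʳ-≤ 0≤κ (1+x≤exp (- x)))) (≤-/ 0<P
            -- Multiplying both sides by exp x and E removes exp (- x) and completes P to the
            -- product P E of `shifted-product-≥`.
            (*-cancelˡ-≤ (*-pos (exp-pos x) (exp-pos (h * σ N))) (begin
            exp x * E * (κ * exp (- x) * G * P)
              ≈⟨ solve 6 (λ e E κ e′ g p → e :* E :* (κ :* e′ :* g :* p) := e :* e′ :* (g :* (κ :* (p :* E)))) refl _ _ _ _ _ _ ⟩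
            exp x * exp (- x) * (G * (κ * (P * E)))    ≈⟨ trans (*-congʳ (exp-inverse x)) (*-identityˡ _) ⟩
            G * (κ * (P * E))                          ≤⟨ *-monoʳ-≤ 0≤Gw (≤-trans (*-monoˡ-≤ (<⇒≤ (*-pos 0<P (exp-pos _))) κ≤)
                                                            (shifted-product-≥ (suc N) 0<k 0<k+h 0<k-h)) ⟩
            G * ∏< (suc N) (λ j → k j + h)             ≈⟨ *-congˡ R≈ ⟩
            G * R                                      ≈⟨ trans Gw*R (*-congˡ exp-wL) ⟩
            f * (e₁ * (exp x * E))                     ≈⟨ solve 3 (λ f e E → f :* (e :* E) := E :* (f :* e)) refl _ _ _ ⟩
            exp x * E * (f * e₁)                       ∎)))
            where
            G = gammaSequence w N
            κ = 1# - C * (h * h)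
            κ≤ : κ ≤ 1# - h * h * ∑< (suc N) (λ j → k j ⁻¹ * k j ⁻¹)
            κ≤ = +-monoʳ-≤ 1# (neg-mono-≤ (≤-trans
              (*-monoʳ-≤ (square-nonneg h) (∑1/[z+j]²-bound (suc N) z (fromℕ-pos m))) (≈⇒≤ (*-comm _ _))))

        Γz-limit : gammaSequence z ⟶ Γ z
        Γz-limit = isGamma z (pos⇒NonPole (fromℕ-pos m))

        Γw-limit : gammaSequence w ⟶ Γ w
        Γw-limit = isGamma w (pos⇒NonPole 0<w)

        x-limit : Step.x ⟶ (h * ψ)
        x-limit = ⟶-*ˡ h log-σ⟶ψ

      Γ-shift-≥ : (1# + h * ψ) * Γ z ≤ Γ w
      Γ-shift-≥ = ⟶-mono-≤ (⟶-* (⟶-+ (⟶-const 1#) x-limit) Γz-limit) Γw-limit 0 (λ N _ → Step.lower N)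

      Γ-shift-≤ : 0# ≤ 1# - C * (h * h) → (1# - C * (h * h)) * (1# - h * ψ) * Γ w ≤ Γ z
      Γ-shift-≤ 0≤κ = ⟶-mono-≤ (⟶-* (⟶-*ˡ _ (⟶-sub (⟶-const 1#) x-limit)) Γw-limit) Γz-limit 0
        (λ N _ → Step.upper N 0≤κ)

      -- Multiplying Γ-shift-≤ by 1 + hψ turns 1 - hψ into 1 - h²ψ².
      Γ-expansion-bound : let D = C + ψ * ψ in
        ∣ h * ψ ∣ < 1# → D * (h * h) + D * (h * h) ≤ 1# →
        ∣ Γ w - Γ z * (1# + h * ψ) ∣ ≤ (1# + 1# + 1# + 1#) * D * Γ z * (h * h)
      Γ-expansion-bound ∣hψ∣<1 2Dhh≤1 = ∣x∣≤ upper (≤-trans (≤-from-gap 0≤g-v′ lower-gap) bound-nonneg)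
        where
        y = h * ψ
        g = Γ w
        v = Γ z
        D = C + ψ * ψ
        d = D * (h * h)
        0≤d : 0# ≤ d
        0≤d = *-nonneg (+-nonneg C-nonneg (square-nonneg ψ)) (square-nonneg h)
        0≤1+y : 0# ≤ 1# + y
        0≤1+y = ≤-cong refl (solve 1 (λ y → con (+ 1) :- (:- y) := con (+ 1) :+ y) refl y)
          (x≤y⇒0≤y-x (≤-trans (-x≤∣x∣ y) (<⇒≤ ∣hψ∣<1)))
        v′≤g : (1# + y) * v ≤ g
        v′≤g = Γ-shift-≥
        0≤v : 0# ≤ v
        0≤v = ⟶-mono-≤ (⟶-const 0#) Γz-limit 0 (λ N _ → Step.0≤Gz N)
        0≤g : 0# ≤ g
        0≤g = ≤-trans (*-nonneg 0≤1+y 0≤v) v′≤g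
        d≤1 : d ≤ 1#
        d≤1 = ≤-trans (≤-from-gap 0≤d refl) 2Dhh≤1
        0≤κ : 0# ≤ 1# - C * (h * h)
        0≤κ = x≤y⇒0≤y-x (≤-trans (*-monoˡ-≤ (square-nonneg h) (≤-from-gap (square-nonneg ψ) refl)) d≤1)
        -- This is the origin of D: (1 - Ch²)(1 - y²) = 1 - (C + ψ²)h² + Ch²y², and the last term is
        -- the gap.
        [1-d]g≤v′ : (1# - d) * g ≤ (1# + y) * v
        [1-d]g≤v′ = begin
          (1# - d) * g
            ≤⟨ ≤-from-gap (*-nonneg (*-nonneg (*-nonneg C-nonneg (square-nonneg h)) (square-nonneg y)) 0≤g)
                 (solve 4 (λ c h p g →
                   (con (+ 1) :- (c :+ p :* p) :* (h :* h)) :* g :+ c :* (h :* h) :* ((h :* p) :* (h :* p)) :* g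
                   := (con (+ 1) :+ h :* p) :* ((con (+ 1) :- c :* (h :* h)) :* (con (+ 1) :- h :* p) :* g)) refl C h ψ g) ⟩
          (1# + y) * ((1# - C * (h * h)) * (1# - y) * g)    ≤⟨ *-monoʳ-≤ 0≤1+y (Γ-shift-≤ 0≤κ) ⟩
          (1# + y) * v ∎
        -- Since 2d ≤ 1 and y < 1, g ≤ 2(1 - d)g ≤ 2(1 + y)v ≤ 4v. This lets the error dg be stated
        -- in terms of v, which does not vary with h.
        g≤4v : g ≤ (1# + 1# + 1# + 1#) * v
        g≤4v = begin
          g                                       ≤⟨ ≤-from-gap (*-nonneg (x≤y⇒0≤y-x 2Dhh≤1) 0≤g)
                                                       (solve 2 (λ d g → g :+ (con (+ 1) :- (d :+ d)) :* g
                                                          := (con (+ 1) :- d) :* g :+ (con (+ 1) :- d) :* g) refl d g) ⟩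
          (1# - d) * g + (1# - d) * g             ≤⟨ +-mono-≤ [1-d]g≤v′ [1-d]g≤v′ ⟩
          (1# + y) * v + (1# + y) * v             ≤⟨ ≤-from-gap (*-nonneg (x≤y⇒0≤y-x (≤-trans (x≤∣x∣ y) (<⇒≤ ∣hψ∣<1))) (+-nonneg 0≤v 0≤v))
                                                       (solve 2 (λ y v → (con (+ 1) :+ y) :* v :+ (con (+ 1) :+ y) :* v :+ (con (+ 1) :- y) :* (v :+ v)
                                                          := (con (+ 1) :+ con (+ 1) :+ con (+ 1) :+ con (+ 1)) :* v) refl y v) ⟩
          (1# + 1# + 1# + 1#) * v                 ∎
        upper : g - v * (1# + y) ≤ (1# + 1# + 1# + 1#) * D * v * (h * h)
        upper = begin
          g - v * (1# + y)                        ≈⟨ +-congˡ (-‿cong (*-comm v _)) ⟩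
          g - (1# + y) * v                        ≤⟨ +-monoʳ-≤ g (neg-mono-≤ [1-d]g≤v′) ⟩
          g - (1# - d) * g                        ≈⟨ solve 2 (λ d g → g :- (con (+ 1) :- d) :* g := d :* g) refl d g ⟩
          d * g                                   ≤⟨ *-monoʳ-≤ 0≤d g≤4v ⟩
          d * ((1# + 1# + 1# + 1#) * v)           ≈⟨ solve 4 (λ d v h c → d :* (h :* h) :* (c :* v) := c :* d :* v :* (h :* h)) refl D v h _ ⟩
          (1# + 1# + 1# + 1#) * D * v * (h * h)   ∎
        0≤g-v′ : 0# ≤ g - (1# + y) * v
        0≤g-v′ = x≤y⇒0≤y-x v′≤g
        lower-gap : - (g - v * (1# + y)) + (g - (1# + y) * v) ≈ 0#
        lower-gap = solve 3 (λ g v y → :- (g :- v :* (con (+ 1) :+ y)) :+ (g :- (con (+ 1) :+ y) :* v) := con (+ 0)) refl g v y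
        bound-nonneg : 0# ≤ (1# + 1# + 1# + 1#) * D * v * (h * h)
        bound-nonneg = ≤-cong refl (solve 4 (λ d v h c → c :* v :* (d :* (h :* h)) := c :* d :* v :* (h :* h)) refl D v h _)
          (*-nonneg (≤-trans 0≤g g≤4v) 0≤d)

  -- Positivity of Γ at positive integers.

  ∏<-fromℕ-suc : ∀ n → ∏< n (fromℕ ∘ suc) ≈ fromℕ (n !)
  ∏<-fromℕ-suc zero    = sym fromℕ-1
  ∏<-fromℕ-suc (suc n) = begin-equality
    ∏< (suc n) (fromℕ ∘ suc)             ≈⟨ ∏<-suc n (fromℕ ∘ suc) ⟩
    ∏< n (fromℕ ∘ suc) * fromℕ (suc n)   ≈⟨ *-congʳ (∏<-fromℕ-suc n) ⟩
    fromℕ (n !) * fromℕ (suc n)          ≈⟨ *-comm _ _ ⟩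
    fromℕ (suc n) * fromℕ (n !)          ≈⟨ fromℕ-* (suc n) (n !) ⟨
    fromℕ (suc n !)                      ∎

  -- Both sides multiply z, z + 1, ..., z + n. It relates the denominators of Euler's sequence at z
  -- + 1 and at z.
  ∏<-shift : ∀ n z → ∏< n (λ j → 1# + z + fromℕ j) * z ≈ ∏< n (λ j → z + fromℕ j) * (z + fromℕ n)
  ∏<-shift n z = begin-equality
    ∏< n (λ j → 1# + z + fromℕ j) * z              ≈⟨ *-cong (∏<-cong n {λ j → 1# + z + fromℕ j} λ j →
                                                        solve 3 (λ i z j → i :+ z :+ j := z :+ (i :+ j)) refl 1# z (fromℕ j)) (sym (+-identityʳ z)) ⟩
    ∏< n (λ j → z + fromℕ (suc j)) * (z + 0#)      ≈⟨ *-comm _ _ ⟩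
    ∏< (suc n) (λ j → z + fromℕ j)                 ≈⟨ ∏<-suc n (λ j → z + fromℕ j) ⟩
    ∏< n (λ j → z + fromℕ j) * (z + fromℕ n)       ∎

  private
    numerator : Carrier → ℕ → Carrier
    numerator z N = fromℕ (N !) * exp (z * log (fromℕ N))

    exp-log-suc : ∀ n → exp (log (fromℕ (suc n))) ≈ fromℕ (suc n)
    exp-log-suc n = isLog _ (fromℕ-pos n)

    numerator-suc : ∀ z n → numerator (1# + z) (suc n) ≈ numerator z (suc n) * fromℕ (suc n)
    numerator-suc z n = begin-equality
      f * exp ((1# + z) * L)       ≈⟨ *-congˡ (trans (exp-cong (solve 2 (λ z l → (con (+ 1) :+ z) :* l := z :* l :+ l) refl z L)) (exp-+ _ _)) ⟩
      f * (exp (z * L) * exp L)    ≈⟨ *-assoc _ _ _ ⟨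
      f * exp (z * L) * exp L      ≈⟨ *-congˡ (exp-log-suc n) ⟩
      numerator z (suc n) * fromℕ (suc n) ∎
      where
      f = fromℕ (suc n !)
      L = log (fromℕ (suc n))

    -- The functional equation Γ(z + 1) = zΓ(z) holds for the Euler sequence up to the
    -- factor N/(z + N + 1) ≥ 1/(z + 2).
    numerator-lower-bound : ∀ m → ∃[ c ] 0# < c ×
      (∀ n → c * ∏≤ (suc n) (λ j → fromℕ (suc m) + fromℕ j) ≤ numerator (fromℕ (suc m)) (suc n))
    -- At z = 1 Euler's sequence is N/(N + 1), which is at least 1/2 for N ≥ 1; this is the constant
    -- c.
    numerator-lower-bound zero with half 1# 0<1
    ... | c , 0<c , c+c≈1 = c , 0<c , λ n → begin
      c * ∏≤ (suc n) (λ j → 1# + 0# + fromℕ j)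
        ≈⟨ *-congˡ (trans (∏<-cong (suc (suc n)) {λ j → 1# + 0# + fromℕ j} λ j → +-congʳ (+-identityʳ 1#)) (∏<-fromℕ-suc (suc (suc n)))) ⟩
      c * fromℕ (suc (suc n) !)                              ≈⟨ *-congˡ (fromℕ-* (suc (suc n)) (suc n !)) ⟩
      c * (fromℕ (suc (suc n)) * fromℕ (suc n !))            ≤⟨ *-monoʳ-≤ (<⇒≤ 0<c) (*-monoˡ-≤ (fromℕ-nonneg (suc n !))
                                                                  (fromℕ-mono-≤ (ℕ.s≤s (ℕₚ.m≤n+m (suc n) n)))) ⟩
      c * (fromℕ (suc n ℕ.+ suc n) * fromℕ (suc n !))        ≈⟨ *-congˡ (*-congʳ (fromℕ-+ (suc n) (suc n))) ⟩
      c * ((fromℕ (suc n) + fromℕ (suc n)) * fromℕ (suc n !)) ≈⟨ solve 3 (λ c n f → c :* ((n :+ n) :* f) := (c :+ c) :* (f :* n)) refl c _ _ ⟩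
      (c + c) * (fromℕ (suc n !) * fromℕ (suc n))            ≈⟨ trans (*-congʳ c+c≈1) (*-identityˡ _) ⟩
      fromℕ (suc n !) * fromℕ (suc n)                        ≈⟨ *-congˡ (trans (exp-cong (solve 1 (λ l → (con (+ 1) :+ con (+ 0)) :* l := l) refl _)) (exp-log-suc n)) ⟨
      numerator (1# + 0#) (suc n)                            ∎
    numerator-lower-bound (suc m) with numerator-lower-bound m
    ... | c , 0<c , bound = c′ , /-pos (*-pos 0<c 0<z) 0<z+2 , λ n →
      let N = fromℕ (suc n)
          P = ∏≤ (suc n) (λ j → z + fromℕ j)
          P′ = ∏≤ (suc n) (λ j → 1# + z + fromℕ j)
          0≤P = <⇒≤ (∏<-pos (suc (suc n)) {λ j → z + fromℕ j} (λ j → +-pos-nonneg 0<z (fromℕ-nonneg j)))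
      in *-cancelˡ-≤ 0<z+2 (begin
      (z + 1# + 1#) * (c * z / (z + 1# + 1#) * P′)           ≈⟨ solve 3 (λ z q p → z :* (q :* p) := q :* z :* p) refl _ _ _ ⟩
      c * z / (z + 1# + 1#) * (z + 1# + 1#) * P′             ≈⟨ *-congʳ (x/y*y≈x (pos⇒≉0 0<z+2)) ⟩
      c * z * P′                                             ≈⟨ solve 3 (λ c z p → c :* z :* p := c :* (p :* z)) refl c z _ ⟩
      c * (P′ * z)                                           ≈⟨ *-congˡ (∏<-shift (suc (suc n)) z) ⟩
      c * (P * (z + (1# + N)))
        ≤⟨ *-monoʳ-≤ (<⇒≤ 0<c) (*-monoʳ-≤ 0≤P
             (≤-from-gap (*-nonneg (+-nonneg (<⇒≤ 0<z) 0≤1) (fromℕ-nonneg n))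
                (solve 2 (λ z n → z :+ (con (+ 1) :+ (con (+ 1) :+ n)) :+ (z :+ con (+ 1)) :* n
                                := (z :+ con (+ 1) :+ con (+ 1)) :* (con (+ 1) :+ n)) refl z (fromℕ n)))) ⟩
      c * (P * ((z + 1# + 1#) * N))                          ≈⟨ solve 4 (λ c p z n → c :* (p :* (z :* n)) := z :* n :* (c :* p)) refl _ _ _ _ ⟩
      (z + 1# + 1#) * N * (c * P)                            ≤⟨ *-monoʳ-≤ (*-nonneg (<⇒≤ 0<z+2) (fromℕ-nonneg (suc n))) (bound n) ⟩
      (z + 1# + 1#) * N * numerator z (suc n)                ≈⟨ trans (*-assoc _ _ _) (*-congˡ (*-comm _ _)) ⟩
      (z + 1# + 1#) * (numerator z (suc n) * N)              ≈⟨ *-congˡ (numerator-suc z n) ⟨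
      (z + 1# + 1#) * numerator (1# + z) (suc n)             ∎)
      where
      z = fromℕ (suc m)
      0<z = fromℕ-pos m
      0<z+2 = +-pos-nonneg (+-pos-nonneg 0<z 0≤1) 0≤1
      c′ = c * z / (z + 1# + 1#)

  -- A positive constant below Euler's sequence also lies below its limit. The threshold 1 leaves
  -- out N = 0, where the logarithm is unconstrained.
  Γ-pos : ∀ m → 0# < Γ (fromℕ (suc m))
  Γ-pos m with numerator-lower-bound m
  ... | c , 0<c , bound = <-≤-trans 0<c (⟶-mono-≤ (⟶-const c) (isGamma z (pos⇒NonPole (fromℕ-pos m))) 1 λ
    { (suc n) _ → ≤-/ (∏<-pos (suc (suc n)) {λ j → z + fromℕ j} (λ j → +-pos-nonneg (fromℕ-pos m) (fromℕ-nonneg j))) (bound n) })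
    where z = fromℕ (suc m)

-- First-order expansions with quadratic remainder.

module FirstOrderExpansions {a ℓ₁ ℓ₂} (K : OrderedField a ℓ₁ ℓ₂) where
  open OrderedField K hiding (zero)
  open RingProperties ring using (-‿involutive)
  open OrderedFieldDefs K
  open OrderedFieldProperties K
  open BigOperatorProperties K
  open Solver using (solve; _:=_; _:+_; _:*_; _:-_; :-_; con)
  open ≤-Reasoning

  -- The neighbourhood of 0 is punctured, as in `HasDerivAt`; this permits division by h and h².
  Near : ∀ {p} → (Carrier → Set p) → Set (a ⊔ ℓ₁ ⊔ ℓ₂ ⊔ p)
  Near P = ∃[ δ ] 0# < δ × (∀ h → h ≉ 0# → ∣ h ∣ < δ → P h)

  near-∧ : ∀ {p q} {P : Carrier → Set p} {Q : Carrier → Set q} → Near P → Near Q → Near (λ h → P h × Q h)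
  near-∧ (δ₁ , 0<δ₁ , P) (δ₂ , 0<δ₂ , Q) with min δ₁ δ₂ 0<δ₁ 0<δ₂
  ... | δ , 0<δ , δ≤δ₁ , δ≤δ₂ = δ , 0<δ , λ h h≉0 ∣h∣<δ →
    P h h≉0 (<-≤-trans ∣h∣<δ δ≤δ₁) , Q h h≉0 (<-≤-trans ∣h∣<δ δ≤δ₂)

  near-map : ∀ {p q} {P : Carrier → Set p} {Q : Carrier → Set q} → (∀ {h} → h ≉ 0# → P h → Q h) → Near P → Near Q
  near-map f (δ , 0<δ , P) = δ , 0<δ , λ h h≉0 ∣h∣<δ → f h≉0 (P h h≉0 ∣h∣<δ)

  always : ∀ {p} {P : Carrier → Set p} → (∀ h → P h) → Near P
  always P = 1# , 0<1 , λ h _ _ → P h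

  near-small : ∀ c {ε} → 0# < ε → Near (λ h → c * ∣ h ∣ < ε)
  -- The added 1 keeps the divisor positive when c is 0.
  near-small c {ε} 0<ε = ε / (∣ c ∣ + 1#) , /-pos 0<ε 0<c+1 , λ h _ ∣h∣<δ → begin-strict
    c * ∣ h ∣                                ≤⟨ *-monoˡ-≤ (∣∣-nonneg h) (≤-trans (x≤∣x∣ c) (≤-from-gap 0≤1 refl)) ⟩
    (∣ c ∣ + 1#) * ∣ h ∣                     <⟨ *-monoʳ-< 0<c+1 ∣h∣<δ ⟩
    (∣ c ∣ + 1#) * (ε / (∣ c ∣ + 1#))        ≈⟨ trans (*-comm _ _) (x/y*y≈x (pos⇒≉0 0<c+1)) ⟩
    ε                                        ∎
    where 0<c+1 = +-nonneg-pos (∣∣-nonneg c) 0<1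

  Bounded : (Carrier → Carrier) → Set (a ⊔ ℓ₁ ⊔ ℓ₂)
  Bounded r = ∃[ B ] Near (λ h → ∣ r h ∣ ≤ B)

  bounded-const : ∀ c → Bounded (λ _ → c)
  bounded-const c = ∣ c ∣ , always (λ _ → ≤-refl)

  bounded-id : Bounded (λ h → h)
  bounded-id = 1# , 1# , 0<1 , λ _ _ → <⇒≤

  bounded-+ : ∀ {r s} → Bounded r → Bounded s → Bounded (λ h → r h + s h)
  bounded-+ (B , r≤B) (C , s≤C) = B + C ,
    near-map (λ _ (p , q) → ≤-trans (∣x+y∣≤∣x∣+∣y∣ _ _) (+-mono-≤ p q)) (near-∧ r≤B s≤C)

  bounded-* : ∀ {r s} → Bounded r → Bounded s → Bounded (λ h → r h * s h)
  bounded-* (B , r≤B) (C , s≤C) = B * C ,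
    near-map (λ _ (p , q) → ≤-trans (∣x*y∣≤∣x∣*∣y∣ _ _) (*-mono-≤ (≤-trans (∣∣-nonneg _) p) (∣∣-nonneg _) p q)) (near-∧ r≤B s≤C)

  bounded-neg : ∀ {r} → Bounded r → Bounded (λ h → - r h)
  bounded-neg (B , r≤B) = B , near-map (λ _ p → ≤-trans (∣-x∣≤∣x∣ _) p) r≤B

  -- Factoring out v makes l the logarithmic derivative, which is additive under products.
  Expansion : (Carrier → Carrier) → Carrier → Carrier → Set (a ⊔ ℓ₁ ⊔ ℓ₂)
  Expansion g v l = ∃[ r ] Bounded r × Near (λ h → g h ≈ v * (1# + l * h) + h * h * r h)

  expansion-cong : ∀ {g v l l′} → l ≈ l′ → Expansion g v l → Expansion g v l′
  expansion-cong l≈l′ (r , r-bounded , g≈) = r , r-bounded ,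
    near-map (λ _ p → trans p (+-congʳ (*-congˡ (+-congˡ (*-congʳ l≈l′))))) g≈

  square-pos : ∀ {h} → h ≉ 0# → 0# < h * h
  square-pos {h} h≉0 with square-nonneg h
  ... | inj₁ 0<hh = 0<hh
  ... | inj₂ 0≈hh = contradiction (*-cancelˡ-≈ h≉0 (trans (sym 0≈hh) (sym (zeroʳ h)))) h≉0

  expansion-from-bound : ∀ {g v l} K → Near (λ h → ∣ g h - v * (1# + l * h) ∣ ≤ K * (h * h)) → Expansion g v l
  expansion-from-bound {g} {v} {l} K bound = r , (K , near-map r≤K bound) , near-map g≈ bound
    where
    e : Carrier → Carrier
    e h = g h - v * (1# + l * h)
    r : Carrier → Carrier
    r h = e h / (h * h)
    r≤K : ∀ {h} → h ≉ 0# → ∣ e h ∣ ≤ K * (h * h) → ∣ r h ∣ ≤ K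
    r≤K {h} h≉0 p = begin
      ∣ e h * (h * h) ⁻¹ ∣            ≤⟨ ∣x*y∣≤∣x∣*∣y∣ _ _ ⟩
      ∣ e h ∣ * ∣ (h * h) ⁻¹ ∣        ≈⟨ *-congˡ (0≤x⇒∣x∣≈x (<⇒≤ (⁻¹-pos (square-pos h≉0)))) ⟩
      ∣ e h ∣ / (h * h)               ≤⟨ /-≤ (square-pos h≉0) p ⟩
      K                               ∎
    g≈ : ∀ {h} → h ≉ 0# → ∣ e h ∣ ≤ K * (h * h) → g h ≈ v * (1# + l * h) + h * h * r h
    g≈ {h} h≉0 _ = begin-equality
      g h                                ≈⟨ solve 2 (λ g x → g := x :+ (g :- x)) refl _ (v * (1# + l * h)) ⟩
      v * (1# + l * h) + e h             ≈⟨ +-congˡ (trans (*-comm _ _) (x/y*y≈x (pos⇒≉0 (square-pos h≉0)))) ⟨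
      v * (1# + l * h) + h * h * r h     ∎

  expansion-* : ∀ {f g v w l m} → Expansion f v l → Expansion g w m → Expansion (λ h → f h * g h) (v * w) (l + m)
  expansion-* {f} {g} {v} {w} {l} {m} (r , r-bounded , f≈) (s , s-bounded , g≈) =
    _ ,
    -- The remainder is vwlm + v(1 + lh)s + w(1 + mh)r + h²rs, all that has order h² or higher in
    -- the product; this term fixes the witness.
    bounded-+ (bounded-+ (bounded-const (v * w * (l * m))) (bounded-+
        (bounded-* (bounded-* (bounded-const v) (linear l)) s-bounded)
        (bounded-* (bounded-* (bounded-const w) (linear m)) r-bounded)))
      (bounded-* (bounded-* bounded-id bounded-id) (bounded-* r-bounded s-bounded)) ,
    near-map (λ {h} _ (p , q) → trans (*-cong p q) (solve 7 (λ v w l m r s h →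
        (v :* (con (+ 1) :+ l :* h) :+ h :* h :* r) :* (w :* (con (+ 1) :+ m :* h) :+ h :* h :* s)
        := v :* w :* (con (+ 1) :+ (l :+ m) :* h)
           :+ h :* h :* (v :* w :* (l :* m) :+ (v :* (con (+ 1) :+ l :* h) :* s :+ w :* (con (+ 1) :+ m :* h) :* r)
                         :+ h :* h :* (r :* s)))
        refl v w l m (r h) (s h) h)) (near-∧ f≈ g≈)
    where
    linear : ∀ l → Bounded (λ h → 1# + l * h)
    linear l = bounded-+ (bounded-const 1#) (bounded-* (bounded-const l) bounded-id)

  -- The candidate (1 - lh)/v times g is 1 - l²h² plus (1 - lh)h²r/v. Dividing by g gives the exact
  -- remainder (l² - (1 - lh)r/v)/g, which is bounded because g ≥ v/2 near 0.
  expansion-⁻¹ : ∀ {g v l} → 0# < v → Expansion g v l → Expansion (λ h → g h ⁻¹) (v ⁻¹) (- l)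
  expansion-⁻¹ {g} {v} {l} 0<v (r , r-bounded , g≈) with half v 0<v
  ... | u , 0<u , u+u≈v =
    _ ,
    bounded-* g⁻¹-bounded (bounded-+ (bounded-const (l * l)) (bounded-neg
      (bounded-* (bounded-* (bounded-const (v ⁻¹)) (bounded-+ (bounded-const 1#) (bounded-* (bounded-const (- l)) bounded-id))) r-bounded))) ,
    near-map (λ {h} _ (p , u≤g) → g⁻¹≈ h p u≤g) (near-∧ g≈ u≤g)
    where
    -- This is (g h - v)/h, so ∣g h - v∣ ≤ B∣h∣ < u = v/2 for small h.
    s : Carrier → Carrier
    s h = v * l + h * r h
    s-bounded : Bounded s
    s-bounded = bounded-+ (bounded-const (v * l)) (bounded-* bounded-id r-bounded)
    B = proj₁ s-bounded
    u≤g : Near (λ h → u ≤ g h)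
    u≤g = near-map (λ {h} _ (p , q , B∣h∣<u) → begin
        u                          ≈⟨ trans (solve 1 (λ u → u := u :+ u :- u) refl u) (+-congʳ u+u≈v) ⟩
        v - u                      ≤⟨ +-monoʳ-≤ v (neg-mono-≤ (<⇒≤ B∣h∣<u)) ⟩
        v - B * ∣ h ∣              ≤⟨ +-monoʳ-≤ v (neg-mono-≤ (≤-trans (∣x*y∣≤∣x∣*∣y∣ _ _) (*-monoˡ-≤ (∣∣-nonneg h) q))) ⟩
        v - ∣ s h * h ∣            ≤⟨ +-monoʳ-≤ v (≤-cong refl (-‿involutive _) (neg-mono-≤ (-x≤∣x∣ (s h * h)))) ⟩
        v + s h * h                ≈⟨ solve 4 (λ v l h r → v :+ (v :* l :+ h :* r) :* h := v :* (con (+ 1) :+ l :* h) :+ h :* h :* r) refl v l h (r h) ⟩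
        v * (1# + l * h) + h * h * r h ≈⟨ p ⟨
        g h                        ∎)
      (near-∧ g≈ (near-∧ (proj₂ s-bounded) (near-small B 0<u)))
    g⁻¹-bounded : Bounded (λ h → g h ⁻¹)
    g⁻¹-bounded = u ⁻¹ , near-map (λ {h} _ u≤g → let 0<g = <-≤-trans 0<u u≤g in begin
      ∣ g h ⁻¹ ∣        ≈⟨ 0≤x⇒∣x∣≈x (<⇒≤ (⁻¹-pos 0<g)) ⟩
      g h ⁻¹            ≈⟨ *-identityˡ _ ⟨
      1# / g h          ≤⟨ /-≤ 0<g (≤-cong (trans (*-comm _ _) (inverseʳ 0<u)) refl (*-monoʳ-≤ (<⇒≤ (⁻¹-pos 0<u)) u≤g)) ⟩
      u ⁻¹              ∎) u≤g
    g⁻¹≈ : ∀ h → g h ≈ v * (1# + l * h) + h * h * r h → u ≤ g h →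
      g h ⁻¹ ≈ v ⁻¹ * (1# + - l * h) + h * h * (g h ⁻¹ * (l * l + - (v ⁻¹ * (1# + - l * h) * r h)))
    g⁻¹≈ h p u≤g = begin-equality
      j                                         ≈⟨ *-identityˡ j ⟨
      1# * j                                    ≈⟨ *-congʳ (inverseʳ 0<v) ⟨
      v * i * j
        ≈⟨ solve 6 (λ v i l h r j → v :* i :* j :=
             i :* (con (+ 1) :+ :- l :* h) :* ((v :* (con (+ 1) :+ l :* h) :+ h :* h :* r) :* j)
               :+ h :* h :* (j :* (v :* i :* (l :* l) :+ :- (i :* (con (+ 1) :+ :- l :* h) :* r)))) refl v i l h (r h) j ⟩
      i * (1# + - l * h) * ((v * (1# + l * h) + h * h * r h) * j)
        + h * h * (j * (v * i * (l * l) + - (i * (1# + - l * h) * r h)))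
        ≈⟨ +-cong (trans (*-congˡ (trans (*-congʳ (sym p)) (inverseʳ (<-≤-trans 0<u u≤g)))) (*-identityʳ _))
                  (*-congˡ (*-congˡ (+-congʳ (trans (*-congʳ (inverseʳ 0<v)) (*-identityˡ _))))) ⟩
      i * (1# + - l * h) + h * h * (j * (l * l + - (i * (1# + - l * h) * r h))) ∎
      where
      i = v ⁻¹
      j = g h ⁻¹

  expansion-product : ∀ {n} (g : Fin n → Carrier → Carrier) (v l : Fin n → Carrier) →
    (∀ i → Expansion (g i) (v i) (l i)) → Expansion (λ h → product (λ i → g i h)) (product v) (sum l)
  expansion-product {zero} g v l _ = (λ _ → 0#) , bounded-const 0# ,
    always (λ h → solve 1 (λ h → con (+ 1) := con (+ 1) :* (con (+ 1) :+ con (+ 0) :* h) :+ h :* h :* con (+ 0)) refl h)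
  expansion-product {suc n} g v l p =
    expansion-* (p Fin.zero) (expansion-product (g ∘ Fin.suc) (v ∘ Fin.suc) (l ∘ Fin.suc) (p ∘ Fin.suc))

  -- The difference quotient misses f(x) l by exactly h r(h), hence by at most B∣h∣.
  expansion⇒HasDerivAt : ∀ {f x l} → Expansion (λ h → f (x + h)) (f x) l → HasDerivAt f x (f x * l)
  expansion⇒HasDerivAt {f} {x} {l} (r , (B , r≤B) , f≈) ε 0<ε =
    near-map error<ε (near-∧ f≈ (near-∧ r≤B (near-small B 0<ε)))
    where
    error<ε : ∀ {h} → h ≉ 0# →
      f (x + h) ≈ f x * (1# + l * h) + h * h * r h × (∣ r h ∣ ≤ B × B * ∣ h ∣ < ε) →
      ∣ (f (x + h) - f x) / h - f x * l ∣ < ε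
    error<ε {h} h≉0 (p , q , B∣h∣<ε) = begin-strict
      ∣ (f (x + h) - f x) / h - f x * l ∣   ≤⟨ ∣∣-≤-cong (trans (+-congʳ (/-unique h≉0 quotient)) (solve 3 (λ v l e → v :* l :+ e :- v :* l := e) refl (f x) l (r h * h))) ⟩
      ∣ r h * h ∣                           ≤⟨ ≤-trans (∣x*y∣≤∣x∣*∣y∣ _ _) (*-monoˡ-≤ (∣∣-nonneg h) q) ⟩
      B * ∣ h ∣                             <⟨ B∣h∣<ε ⟩
      ε                                     ∎
      where
      quotient : (f x * l + r h * h) * h ≈ f (x + h) - f x
      quotient = trans (solve 4 (λ v l h r → (v :* l :+ r :* h) :* h := v :* (con (+ 1) :+ l :* h) :+ h :* h :* r :- v) refl (f x) l h (r h))
        (+-congʳ (sym p))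

-- The quotient of gamma products and its derivative.

module GammaQuotientProperties {a ℓ₁ ℓ₂} (ℝ : RealField a ℓ₁ ℓ₂)
  (exp log : RealField.Carrier ℝ → RealField.Carrier ℝ) (isExp : GammaDefs.IsExp ℝ exp) (isLog : GammaDefs.IsLog ℝ exp log)
  (γ : RealField.Carrier ℝ) (isEulerConstant : GammaDefs.IsEulerConstant ℝ log γ)
  (Γ : RealField.Carrier ℝ → RealField.Carrier ℝ) (isGamma : GammaDefs.IsGamma ℝ exp log Γ) where
  open GammaDefs ℝ
  open OrderedFieldProperties orderedField
  open BigOperatorProperties orderedField
  open FirstOrderExpansions orderedField
  open GammaProperties ℝ exp log isExp isLog γ isEulerConstant Γ isGamma
  open Solver using (solve; _:=_; _:+_; _:*_; _:-_; :-_; con)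
  open ≤-Reasoning

  index : ℤ → ℤ → ℕ → ℕ → ℤ
  index α β n k = α ℤ.* + n ℤ.+ β ℤ.* + k

  gammaArg≈index+1 : ∀ α β n k → gammaArg α β n (fromℕ k) ≈ fromℤ (index α β n k) + 1#
  gammaArg≈index+1 α β n k =
    +-congʳ (sym (trans (fromℤ-+ (α ℤ.* + n) (β ℤ.* + k)) (+-cong (fromℤ-* α (+ n)) (fromℤ-* β (+ k)))))

  -- A negative index -(m + 1) would put the gamma argument at the pole -m. Hence `H` is only taken
  -- where it is a harmonic number.
  nonPole⇒index-nonneg : ∀ α β n k → NonPole (gammaArg α β n (fromℕ k)) → ∃[ m ] index α β n k ≡ + m
  nonPole⇒index-nonneg α β n k nonPole with index α β n k | gammaArg≈index+1 α β n k
  ... | + m      | _   = m , ≡.refl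
  ... | -[1+ m ] | arg = contradiction
    (trans arg (solve 2 (λ i m → :- (i :+ m) :+ i := :- m) refl 1# (fromℕ m))) (nonPole m)

  module _ (α β : ℤ) (n k : ℕ) (nonPole : NonPole (gammaArg α β n (fromℕ k))) where
    private
      m = proj₁ (nonPole⇒index-nonneg α β n k nonPole)
      index≡m = proj₂ (nonPole⇒index-nonneg α β n k nonPole)
      open AtSuc m using (z; ψ; C; C-nonneg; Γ-expansion-bound)

      b = fromℤ β
      D = C + ψ * ψ
      -- Chosen so that E∣h∣ < 1 and ∣h∣ < 1 give 2D(bh)² ≤ 1, as `Γ-expansion-bound` demands for
      -- the increment bh.
      E = (D + D) * (b * b)

      arg≈z : gammaArg α β n (fromℕ k) ≈ z
      arg≈z = trans (gammaArg≈index+1 α β n k) (trans (+-congʳ (reflexive (≡.cong fromℤ index≡m))) (+-comm _ _))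

      Γarg≈Γz : Γ (gammaArg α β n (fromℕ k)) ≈ Γ z
      Γarg≈Γz = Γ-cong arg≈z nonPole

    Γ-arg-pos : 0# < Γ (gammaArg α β n (fromℕ k))
    Γ-arg-pos = <-cong refl (sym Γarg≈Γz) (Γ-pos m)

    -- The chain rule for the increment bh: ψ becomes bψ and the error acquires b². It is applied to
    -- `Γ-expansion-bound`, which also holds at increment 0, so b = 0 is no exception.
    Γ-arg-expansion : Expansion (λ h → Γ (gammaArg α β n (fromℕ k + h))) (Γ (gammaArg α β n (fromℕ k)))
                                (b * (H (index α β n k) - γ))
    Γ-arg-expansion = expansion-cong (*-congˡ (+-congʳ (reflexive (≡.cong H (≡.sym index≡m)))))
      (expansion-from-bound ((1# + 1# + 1# + 1#) * D * Γ z * (b * b))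
        (near-map (λ { {h} _ (p , q , s , t) → bound h p q s t })
          (near-∧ (near-small 1# 0<1) (near-∧ (near-small ∣ b ∣ 0<1) (near-∧ (near-small ∣ b * ψ ∣ 0<1) (near-small E 0<1))))))
      where
      bound : ∀ h → 1# * ∣ h ∣ < 1# → ∣ b ∣ * ∣ h ∣ < 1# → ∣ b * ψ ∣ * ∣ h ∣ < 1# → E * ∣ h ∣ < 1# →
        ∣ Γ (gammaArg α β n (fromℕ k + h)) - Γ (gammaArg α β n (fromℕ k)) * (1# + b * ψ * h) ∣
          ≤ (1# + 1# + 1# + 1#) * D * Γ z * (b * b) * (h * h)
      bound h ∣h∣<1 ∣bh∣<1 ∣bψh∣<1 Eh<1 = begin
        ∣ Γ w - Γ (gammaArg α β n (fromℕ k)) * (1# + b * ψ * h) ∣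
          ≤⟨ ∣∣-≤-cong (+-congˡ (-‿cong (*-cong Γarg≈Γz (+-congˡ (solve 3 (λ b p h → b :* p :* h := b :* h :* p) refl b ψ h))))) ⟩
        ∣ Γ w - Γ z * (1# + b * h * ψ) ∣
          ≤⟨ Γ-expansion-bound (≤-<-trans (∣x*y∣≤∣x∣*∣y∣ b h) ∣bh∣<1) w≈z+bh
               (≤-<-trans (≤-trans (∣∣-≤-cong (solve 3 (λ b p h → b :* h :* p := b :* p :* h) refl b ψ h)) (∣x*y∣≤∣x∣*∣y∣ _ h)) ∣bψh∣<1)
               2D[bh]²≤1 ⟩
        (1# + 1# + 1# + 1#) * D * Γ z * (b * h * (b * h))
          ≈⟨ solve 3 (λ c b h → c :* (b :* h :* (b :* h)) := c :* (b :* b) :* (h :* h)) refl _ b h ⟩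
        (1# + 1# + 1# + 1#) * D * Γ z * (b * b) * (h * h) ∎
        where
        w = gammaArg α β n (fromℕ k + h)
        w≈z+bh : w ≈ z + b * h
        w≈z+bh = trans (solve 5 (λ x b k h i → x :+ b :* (k :+ h) :+ i := x :+ b :* k :+ i :+ b :* h) refl (fromℤ α * fromℕ n) b (fromℕ k) h 1#)
          (+-congʳ arg≈z)
        0≤E : 0# ≤ E
        0≤E = *-nonneg (+-nonneg 0≤D 0≤D) (square-nonneg b)
          where 0≤D = +-nonneg C-nonneg (square-nonneg ψ)
        2D[bh]²≤1 : D * (b * h * (b * h)) + D * (b * h * (b * h)) ≤ 1#
        2D[bh]²≤1 = begin
          D * (b * h * (b * h)) + D * (b * h * (b * h))   ≈⟨ solve 3 (λ d b h → d :* (b :* h :* (b :* h)) :+ d :* (b :* h :* (b :* h)) := (d :+ d) :* (b :* b) :* (h :* h)) refl D b h ⟩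
          E * (h * h)                                     ≤⟨ *-monoʳ-≤ 0≤E (≤-trans (x≤∣x∣ _) (∣x*y∣≤∣x∣*∣y∣ h h)) ⟩
          E * (∣ h ∣ * ∣ h ∣)                             ≈⟨ *-assoc _ _ _ ⟨
          E * ∣ h ∣ * ∣ h ∣                               ≤⟨ *-monoˡ-≤ (∣∣-nonneg h) (<⇒≤ Eh<1) ⟩
          1# * ∣ h ∣                                      ≤⟨ <⇒≤ ∣h∣<1 ⟩
          1#                                              ∎

  sum-β[H-γ] : ∀ {r} (α β : Fin r → ℤ) n k →
    sum (λ j → fromℤ (β j) * (H (index (α j) (β j) n k) - γ)) ≈ ∑βH α β n k - γ * fromℤ (∑ℤ β)
  sum-β[H-γ] {zero} α β n k = solve 1 (λ γ → con (+ 0) := con (+ 0) :- γ :* con (+ 0)) refl γ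
  sum-β[H-γ] {suc r} α β n k = begin-equality
    b * (x - γ) + sum (λ j → fromℤ (β (Fin.suc j)) * (H (index (α (Fin.suc j)) (β (Fin.suc j)) n k) - γ))
      ≈⟨ +-congˡ (sum-β[H-γ] (α ∘ Fin.suc) (β ∘ Fin.suc) n k) ⟩
    b * (x - γ) + (S - γ * B)                ≈⟨ solve 5 (λ b x γ s B → b :* (x :- γ) :+ (s :- γ :* B) := b :* x :+ s :- γ :* (b :+ B)) refl b x γ S B ⟩
    b * x + S - γ * (b + B)                  ≈⟨ +-congˡ (-‿cong (*-congˡ (fromℤ-+ (β Fin.zero) _))) ⟨
    ∑βH α β n k - γ * fromℤ (∑ℤ β)           ∎
    where
    b = fromℤ (β Fin.zero)
    x = H (index (α Fin.zero) (β Fin.zero) n k)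
    S = ∑βH (α ∘ Fin.suc) (β ∘ Fin.suc) n k
    B = fromℤ (∑ℤ (β ∘ Fin.suc))

  ∏Γ-expansion : ∀ {r} (α β : Fin r → ℤ) n k → (∀ j → NonPole (gammaArg (α j) (β j) n (fromℕ k))) →
    Expansion (λ h → ∏Γ Γ α β n (fromℕ k + h)) (∏Γ Γ α β n (fromℕ k)) (∑βH α β n k - γ * fromℤ (∑ℤ β))
  ∏Γ-expansion α β n k nonPole = expansion-cong (sum-β[H-γ] α β n k)
    (expansion-product (λ j h → Γ (gammaArg (α j) (β j) n (fromℕ k + h))) _ _
      (λ j → Γ-arg-expansion (α j) (β j) n k (nonPole j)))

  gammaQuotient-HasDerivAt : ∀ {s u} (a b : Fin s → ℤ) (c d : Fin u → ℤ) n k →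
    (∀ j → NonPole (gammaArg (a j) (b j) n (fromℕ k))) →
    (∀ j → NonPole (gammaArg (c j) (d j) n (fromℕ k))) →
    HasDerivAt (gammaQuotient Γ a b c d n) (fromℕ k)
      (gammaQuotient Γ a b c d n (fromℕ k) *
        ((∑βH a b n k - γ * fromℤ (∑ℤ b)) - (∑βH c d n k - γ * fromℤ (∑ℤ d))))
  gammaQuotient-HasDerivAt a b c d n k ab-nonPole cd-nonPole = expansion⇒HasDerivAt
    {gammaQuotient Γ a b c d n} {fromℕ k}
    (expansion-* (∏Γ-expansion a b n k ab-nonPole)
      (expansion-⁻¹ (product-pos (λ j → Γ-arg-pos (c j) (d j) n k (cd-nonPole j))) (∏Γ-expansion c d n k cd-nonPole)))

  -- The coefficient of -γ in each summand is the constant B - B′ times F k, so it leaves the sum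
  -- and forms q.
  sum-derivatives : ∀ N (F A A′ : ℕ → Carrier) (B B′ : ℤ) →
    ∑< N (λ k → F k * ((A k - γ * fromℤ B) - (A′ k - γ * fromℤ B′)))
      ≈ ∑< N (λ k → F k * (A k - A′ k)) - γ * (fromℤ (B ℤ.- B′) * ∑< N F)
  sum-derivatives N F A A′ B B′ = begin-equality
    ∑< N (λ k → F k * ((A k - γ * fromℤ B) - (A′ k - γ * fromℤ B′)))
      ≈⟨ ∑<-cong N {λ k → F k * ((A k - γ * fromℤ B) - (A′ k - γ * fromℤ B′))} (λ k → trans
           (solve 6 (λ f x x′ γ b b′ → f :* ((x :- γ :* b) :- (x′ :- γ :* b′)) := f :* (x :- x′) :+ (:- (γ :* (b :+ (:- b′)))) :* f)
             refl (F k) (A k) (A′ k) γ (fromℤ B) (fromℤ B′))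
           (+-congˡ (*-congʳ (-‿cong (*-congˡ (sym (trans (fromℤ-+ B (ℤ.- B′)) (+-congˡ (fromℤ-neg B′))))))))) ⟩
    ∑< N (λ k → F k * (A k - A′ k) + - (γ * fromℤ (B ℤ.- B′)) * F k)
      ≈⟨ trans (∑<-+ N (λ k → F k * (A k - A′ k)) (λ k → - (γ * fromℤ (B ℤ.- B′)) * F k)) (+-congˡ (∑<-*ˡ N _ F)) ⟩
    ∑< N (λ k → F k * (A k - A′ k)) + - (γ * fromℤ (B ℤ.- B′)) * ∑< N F
      ≈⟨ +-congˡ (solve 3 (λ γ b s → :- (γ :* b) :* s := :- (γ :* (b :* s))) refl γ _ _) ⟩
    ∑< N (λ k → F k * (A k - A′ k)) - γ * (fromℤ (B ℤ.- B′) * ∑< N F) ∎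

proposition3 :
    ∀ {r ℓ₁ ℓ₂} (ℝ : RealField r ℓ₁ ℓ₂) → let open GammaDefs ℝ in
    (exp log : Carrier → Carrier) → IsExp exp → IsLog exp log →
    (γ : Carrier) → IsEulerConstant log γ →
    (Γ : Carrier → Carrier) → IsGamma exp log Γ →
    (s u : ℕ) (a b : Fin s → ℤ) (c d : Fin u → ℤ) →
    ∑ℤ b ≢ ∑ℤ d →
    (M : ℕ → ℕ) →
    (∀ n t → t ℕ.≤ M n →
      (∀ j → NonPole (gammaArg (a j) (b j) n (fromℕ t))) ×
      (∀ j → NonPole (gammaArg (c j) (d j) n (fromℕ t)))) →
    let F : ℕ → Carrier → Carrier
        F = gammaQuotient Γ a b c d
        q : ℕ → Carrier
        q n = fromℤ (∑ℤ b ℤ.- ∑ℤ d) * ∑≤ (M n) (λ k → F n (fromℕ k))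
        p : ℕ → Carrier
        p n = ∑≤ (M n) (λ k → F n (fromℕ k) * (∑βH a b n k - ∑βH c d n k))
    in
    ∀ n → Σ[ F′ ∈ (ℕ → Carrier) ]
      (∀ t → t ℕ.≤ M n → HasDerivAt (F n) (fromℕ t) (F′ t)) ×
      ∑≤ (M n) F′ ≈ p n - γ * q n
proposition3 ℝ exp log isExp isLog γ isEulerConstant Γ isGamma s u a b c d _ M nonPole n =
  -- The sequence is given at every t by the formula of `gammaQuotient-HasDerivAt`; it is claimed to
  -- be the derivative for t ≤ M n.
  _ ,
  (λ t t≤M → gammaQuotient-HasDerivAt a b c d n t (proj₁ (nonPole n t t≤M)) (proj₂ (nonPole n t t≤M))) ,
  sum-derivatives (suc (M n)) (λ k → gammaQuotient Γ a b c d n (fromℕ k)) (∑βH a b n) (∑βH c d n) (∑ℤ b) (∑ℤ d)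
  where
  open GammaDefs ℝ
  open GammaQuotientProperties ℝ exp log isExp isLog γ isEulerConstant Γ isGamma
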